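{- Let $d=1$. For $x\in\mathbb{R}$, $$\#\Phi(x)=\begin{cases}\aleph_0 & \text{if } x\in\mathbb{Q},\\ 2^{\aleph_0} & \text{if } x\in\mathrm{WA}\setminus\mathbb{Q},\\ 0 & \text{if } x\in\mathrm{Bad}.\end{cases}$$
   Context: For $t\in\mathbb{R}$, $\|t\|$ is the distance from $t$ to $\mathbb{Z}$. Write $\mathbb{N}=\{1,2,\dots\}$. $\mathrm{Bad}=\{x\in\mathbb{R}:\inf_{n\in\mathbb{N}}n\|nx\|>0\}$ and $\mathrm{WA}=\mathbb{R}\setminus\mathrm{Bad}$. $\mathcal{D}$ is the set of all non-increasing $\psi:\mathbb{N}\to\mathbb{R}_{\ge0}$ with $\sum_n\psi(n)=\infty$. $W(\psi)$ is the set of $(x,y)\in\mathbb{R}^2$ with $\|nx+y\|<\psi(n)$ for infinitely many $n\in\mathbb{N}$. $\Pi=\bigcap_{\psi\in\mathcal{D}}W(\psi)$ and $\Phi(x)=\{y\in\mathbb{R}:(x,y)\in\Pi\}$. -}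

module Defs where

open import Data.Bool.Base using (Bool)
open import Data.Empty using (⊥)
open import Data.Integer.Base as ℤ using (ℤ; +_)
import Data.Integer.Properties as ℤ
open import Data.Integer.DivMod using ([n/d]*d≤n; n<s[n/ℕd]*d; div-pos-is-/ℕ)
open import Data.Nat.Base as ℕ using (ℕ; zero; suc; NonZero)
import Data.Nat.Properties as ℕ
open import Data.Product.Base using (∃; _×_; _,_; proj₁; proj₂)
open import Data.Rational.Base as ℚ using (ℚ; 0ℚ; 1ℚ; ½; floor; mkℚ)
import Data.Rational.Properties as ℚ
open import Data.Rational.Solver using (module +-*-Solver)
import Data.Rational.Unnormalised.Base as ℚᵘ
import Data.Rational.Unnormalised.Properties as ℚᵘ
open import Data.Sum.Base using (inj₁; inj₂)
open import Function.Base using (_∘_)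
open import Function.Bundles using (Bijection)
open import Level using (0ℓ)
open import Relation.Binary.Bundles using (Setoid)
import Relation.Binary.Construct.On as On
open import Relation.Binary.Definitions using (tri<; tri≈; tri>)
open import Relation.Binary.PropositionalEquality
  using (_≡_; refl; sym; trans; cong; subst; subst₂; _→-setoid_)
import Relation.Binary.PropositionalEquality.Properties as ≡
open import Relation.Unary using (Pred; _∈_; ∁)

open import Algebra.Bundles.Raw using (RawMonoid)
import Algebra.Definitions.RawMonoid as RawMonoidOps

∣_-_∣ℚ : ℚ → ℚ → ℚ
∣ p - q ∣ℚ = ℚ.∣ p ℚ.- q ∣

module _ where
  open +-*-Solver

  ∣-∣ℚ-sym : ∀ p q → ∣ p - q ∣ℚ ≡ ∣ q - p ∣ℚ
  ∣-∣ℚ-sym p q = trans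
    (cong ℚ.∣_∣ (solve 2 (λ p q → p :- q := :- (q :- p)) refl p q))
    (ℚ.∣-p∣≡∣p∣ (q ℚ.- p))

  ∣-∣ℚ-triangle : ∀ p q r → ∣ p - r ∣ℚ ℚ.≤ ∣ p - q ∣ℚ ℚ.+ ∣ q - r ∣ℚ
  ∣-∣ℚ-triangle p q r = ℚ.≤-trans
    (ℚ.≤-reflexive (cong ℚ.∣_∣
      (solve 3 (λ p q r → p :- r := (p :- q) :+ (q :- r)) refl p q r)))
    (ℚ.∣p+q∣≤∣p∣+∣q∣ (p ℚ.- q) (q ℚ.- r))

  p+q-q : ∀ p q → p ℚ.+ q ℚ.- q ≡ p
  p+q-q = solve 2 (λ p q → p :+ q :- q := p) refl

  p-q+q : ∀ p q → p ℚ.- q ℚ.+ q ≡ p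
  p-q+q = solve 2 (λ p q → p :- q :+ q := p) refl

  +-interchange-- : ∀ a b c d →
    (a ℚ.+ b) ℚ.- (c ℚ.+ d) ≡ (a ℚ.- c) ℚ.+ (b ℚ.- d)
  +-interchange-- =
    solve 4 (λ a b c d → (a :+ b) :- (c :+ d) := (a :- c) :+ (b :- d)) refl

  neg-- : ∀ p q → (ℚ.- p) ℚ.- (ℚ.- q) ≡ q ℚ.- p
  neg-- = solve 2 (λ p q → (:- p) :- (:- q) := q :- p) refl

  neg-diff : ∀ p q → ℚ.- (p ℚ.- q) ≡ q ℚ.- p
  neg-diff = solve 2 (λ p q → :- (p :- q) := q :- p) refl

½ε+½ε : ∀ ε → ½ ℚ.* ε ℚ.+ ½ ℚ.* ε ≡ ε
½ε+½ε ε = trans (sym (ℚ.*-distribʳ-+ ε ½ ½)) (ℚ.*-identityˡ ε)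

½ε>0 : ∀ {ε} → 0ℚ ℚ.< ε → 0ℚ ℚ.< ½ ℚ.* ε
½ε>0 {ε} ε>0 = subst (ℚ._< ½ ℚ.* ε) (ℚ.*-zeroʳ ½) (ℚ.*-monoʳ-<-pos ½ ε>0)

p≤q+r⇒p-r≤q : ∀ {p q} r → p ℚ.≤ q ℚ.+ r → p ℚ.- r ℚ.≤ q
p≤q+r⇒p-r≤q {p} {q} r h =
  subst (p ℚ.- r ℚ.≤_) (p+q-q q r) (ℚ.+-monoˡ-≤ (ℚ.- r) h)

p-r≤q⇒p≤q+r : ∀ {p q} r → p ℚ.- r ℚ.≤ q → p ℚ.≤ q ℚ.+ r
p-r≤q⇒p≤q+r {p} {q} r h =
  subst (ℚ._≤ q ℚ.+ r) (p-q+q p r) (ℚ.+-monoˡ-≤ r h)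

p≤∣p∣ : ∀ p → p ℚ.≤ ℚ.∣ p ∣
p≤∣p∣ p with ℚ.≤-total 0ℚ p
... | inj₁ 0≤p = ℚ.≤-reflexive (sym (ℚ.0≤p⇒∣p∣≡p 0≤p))
... | inj₂ p≤0 = ℚ.≤-trans p≤0 (ℚ.0≤∣p∣ p)

∣p∣≤ : ∀ {p q} → p ℚ.≤ q → ℚ.- p ℚ.≤ q → ℚ.∣ p ∣ ℚ.≤ q
∣p∣≤ {p} {q} h h′ with ℚ.∣p∣≡p∨∣p∣≡-p p
... | inj₁ eq = subst (ℚ._≤ q) (sym eq) h
... | inj₂ eq = subst (ℚ._≤ q) (sym eq) h′

∣∣p∣-∣q∣∣≤∣p-q∣ : ∀ p q → ∣ ℚ.∣ p ∣ - ℚ.∣ q ∣ ∣ℚ ℚ.≤ ∣ p - q ∣ℚ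
∣∣p∣-∣q∣∣≤∣p-q∣ p q = ∣p∣≤ (half p q)
  (subst₂ ℚ._≤_ (sym (neg-diff ℚ.∣ p ∣ ℚ.∣ q ∣)) (∣-∣ℚ-sym q p) (half q p))
  where
  half : ∀ p q → ℚ.∣ p ∣ ℚ.- ℚ.∣ q ∣ ℚ.≤ ∣ p - q ∣ℚ
  half p q = p≤q+r⇒p-r≤q ℚ.∣ q ∣ (subst
    (λ z → ℚ.∣ z ∣ ℚ.≤ ∣ p - q ∣ℚ ℚ.+ ℚ.∣ q ∣) (p-q+q p q)
    (ℚ.∣p+q∣≤∣p∣+∣q∣ (p ℚ.- q) q))

ℤ⇒ℚ : ℤ → ℚ
ℤ⇒ℚ i = i ℚ./ 1

-- Halves round up, unlike `Data.Rational.round`.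
nearest : ℚ → ℤ
nearest q = floor (q ℚ.+ ½)

‖_‖ℚ : ℚ → ℚ
‖ q ‖ℚ = ∣ q - ℤ⇒ℚ (nearest q) ∣ℚ

module _ where
  toℚᵘ-ℤ⇒ℚ : ∀ i → ℚ.toℚᵘ (ℤ⇒ℚ i) ℚᵘ.≃ ℚᵘ.mkℚᵘ i 0
  toℚᵘ-ℤ⇒ℚ i = ℚ.toℚᵘ-fromℚᵘ (ℚᵘ.mkℚᵘ i 0)

  ℤ⇒ℚ-suc : ∀ i → ℤ⇒ℚ (ℤ.suc i) ≡ ℤ⇒ℚ i ℚ.+ 1ℚ
  ℤ⇒ℚ-suc i = ℚ.toℚᵘ-injective (begin-equality
    ℚ.toℚᵘ (ℤ⇒ℚ (ℤ.suc i))              ≃⟨ toℚᵘ-ℤ⇒ℚ (ℤ.suc i) ⟩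
    ℚᵘ.mkℚᵘ (ℤ.suc i) 0                 ≃⟨ ℚᵘ.*≡* (cong (ℤ._* + 1)
      (trans (ℤ.+-comm (+ 1) i) (cong (ℤ._+ + 1) (sym (ℤ.*-identityʳ i))))) ⟩
    ℚᵘ.mkℚᵘ i 0 ℚᵘ.+ ℚᵘ.1ℚᵘ             ≃⟨ ℚᵘ.+-congˡ ℚᵘ.1ℚᵘ (toℚᵘ-ℤ⇒ℚ i) ⟨
    ℚ.toℚᵘ (ℤ⇒ℚ i) ℚᵘ.+ ℚ.toℚᵘ 1ℚ       ≃⟨ ℚ.toℚᵘ-homo-+ (ℤ⇒ℚ i) 1ℚ ⟨
    ℚ.toℚᵘ (ℤ⇒ℚ i ℚ.+ 1ℚ)               ∎)
    where open ℚᵘ.≤-Reasoning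

  ℤ⇒ℚ-mono-≤ : ∀ {i j} → i ℤ.≤ j → ℤ⇒ℚ i ℚ.≤ ℤ⇒ℚ j
  ℤ⇒ℚ-mono-≤ {i} {j} i≤j = ℚ.toℚᵘ-cancel-≤ (begin
    ℚ.toℚᵘ (ℤ⇒ℚ i)  ≃⟨ toℚᵘ-ℤ⇒ℚ i ⟩
    ℚᵘ.mkℚᵘ i 0     ≤⟨ ℚᵘ.*≤* (ℤ.*-monoʳ-≤-nonNeg (+ 1) i≤j) ⟩
    ℚᵘ.mkℚᵘ j 0     ≃⟨ toℚᵘ-ℤ⇒ℚ j ⟨
    ℚ.toℚᵘ (ℤ⇒ℚ j)  ∎)
    where open ℚᵘ.≤-Reasoning

  floor≤ : ∀ q → ℤ⇒ℚ (floor q) ℚ.≤ q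
  floor≤ q@(mkℚ n d-1 _) = ℚ.toℚᵘ-cancel-≤ (begin
    ℚ.toℚᵘ (ℤ⇒ℚ (floor q))  ≃⟨ toℚᵘ-ℤ⇒ℚ (floor q) ⟩
    ℚᵘ.mkℚᵘ (floor q) 0     ≤⟨ ℚᵘ.*≤* (subst (floor q ℤ.* + suc d-1 ℤ.≤_)
                                 (sym (ℤ.*-identityʳ n)) ([n/d]*d≤n n (+ suc d-1))) ⟩
    ℚ.toℚᵘ q                ∎)
    where open ℚᵘ.≤-Reasoning

  <1+floor : ∀ q → q ℚ.< ℤ⇒ℚ (ℤ.suc (floor q))
  <1+floor q@(mkℚ n d-1 _) = ℚ.toℚᵘ-cancel-< (begin-strict
    ℚ.toℚᵘ q                        <⟨ ℚᵘ.*<* (subst₂ ℤ._<_ (sym (ℤ.*-identityʳ n))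
      (cong (λ z → ℤ.suc z ℤ.* + suc d-1) (sym (div-pos-is-/ℕ n (suc d-1))))
      (n<s[n/ℕd]*d n (suc d-1))) ⟩
    ℚᵘ.mkℚᵘ (ℤ.suc (floor q)) 0     ≃⟨ toℚᵘ-ℤ⇒ℚ (ℤ.suc (floor q)) ⟨
    ℚ.toℚᵘ (ℤ⇒ℚ (ℤ.suc (floor q)))  ∎)
    where open ℚᵘ.≤-Reasoning

  module _ (q : ℚ) where
    private
      m = ℤ⇒ℚ (nearest q)

    nearest-lower : m ℚ.- ½ ℚ.≤ q
    nearest-lower = p≤q+r⇒p-r≤q ½ (floor≤ (q ℚ.+ ½))

    nearest-upper : q ℚ.≤ m ℚ.+ ½
    nearest-upper = subst₂ ℚ._≤_ (p+q-q q ½)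
      (trans (cong (ℚ._- ½) (ℤ⇒ℚ-suc (nearest q))) (ℚ.+-assoc m 1ℚ (ℚ.- ½)))
      (ℚ.+-monoˡ-≤ (ℚ.- ½) (ℚ.<⇒≤ (<1+floor (q ℚ.+ ½))))

    ‖‖ℚ≤½ : ‖ q ‖ℚ ℚ.≤ ½
    ‖‖ℚ≤½ = ∣p∣≤
      (p≤q+r⇒p-r≤q m (subst (q ℚ.≤_) (ℚ.+-comm m ½) nearest-upper))
      (subst (ℚ._≤ ½) (sym (neg-diff q m))
        (p≤q+r⇒p-r≤q q (subst (m ℚ.≤_) (ℚ.+-comm q ½) (p-r≤q⇒p≤q+r ½ nearest-lower))))

-- `nearest` does attain the minimum of ∣ q - k ∣ over the integers k.
‖‖ℚ-minimal : ∀ q k → ‖ q ‖ℚ ℚ.≤ ∣ q - ℤ⇒ℚ k ∣ℚ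
‖‖ℚ-minimal q k with ℤ.<-cmp k (nearest q)
... | tri≈ _ refl _ = ℚ.≤-refl
... | tri< k<m _ _ = ℚ.≤-trans (‖‖ℚ≤½ q) (ℚ.≤-trans
        (subst (ℚ._≤ q ℚ.- κ) (p+q-q ½ κ) (ℚ.+-monoˡ-≤ (ℚ.- κ) ½+κ≤q))
        (p≤∣p∣ (q ℚ.- κ)))
  where
  open ℚ.≤-Reasoning
  κ = ℤ⇒ℚ k
  ½+κ≤q : ½ ℚ.+ κ ℚ.≤ q
  ½+κ≤q = begin
    ½ ℚ.+ κ                    ≡⟨ ℚ.+-comm ½ κ ⟩
    κ ℚ.+ ½                    ≡⟨ ℚ.+-assoc κ 1ℚ (ℚ.- ½) ⟨
    (κ ℚ.+ 1ℚ) ℚ.- ½           ≡⟨ cong (ℚ._- ½) (ℤ⇒ℚ-suc k) ⟨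
    ℤ⇒ℚ (ℤ.suc k) ℚ.- ½        ≤⟨ ℚ.+-monoˡ-≤ (ℚ.- ½) (ℤ⇒ℚ-mono-≤ (ℤ.i<j⇒suc[i]≤j k<m)) ⟩
    ℤ⇒ℚ (nearest q) ℚ.- ½      ≤⟨ nearest-lower q ⟩
    q                          ∎
... | tri> _ _ m<k = ℚ.≤-trans (‖‖ℚ≤½ q) (ℚ.≤-trans
        (subst (ℚ._≤ κ ℚ.- q) (p+q-q ½ q) (ℚ.+-monoˡ-≤ (ℚ.- q) ½+q≤κ))
        (subst (κ ℚ.- q ℚ.≤_) (∣-∣ℚ-sym κ q) (p≤∣p∣ (κ ℚ.- q))))
  where
  open ℚ.≤-Reasoning
  κ = ℤ⇒ℚ k
  m = ℤ⇒ℚ (nearest q)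
  ½+q≤κ : ½ ℚ.+ q ℚ.≤ κ
  ½+q≤κ = begin
    ½ ℚ.+ q                    ≤⟨ ℚ.+-monoʳ-≤ ½ (nearest-upper q) ⟩
    ½ ℚ.+ (m ℚ.+ ½)            ≡⟨ ℚ.+-comm ½ (m ℚ.+ ½) ⟩
    (m ℚ.+ ½) ℚ.+ ½            ≡⟨ ℚ.+-assoc m ½ ½ ⟩
    m ℚ.+ 1ℚ                   ≡⟨ ℤ⇒ℚ-suc (nearest q) ⟨
    ℤ⇒ℚ (ℤ.suc (nearest q))    ≤⟨ ℤ⇒ℚ-mono-≤ (ℤ.i<j⇒suc[i]≤j m<k) ⟩
    κ                          ∎

∣‖p‖-‖q‖∣≤∣p-q∣ : ∀ p q → ∣ ‖ p ‖ℚ - ‖ q ‖ℚ ∣ℚ ℚ.≤ ∣ p - q ∣ℚ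
∣‖p‖-‖q‖∣≤∣p-q∣ p q = ∣p∣≤ (half p q)
  (subst₂ ℚ._≤_ (sym (neg-diff ‖ p ‖ℚ ‖ q ‖ℚ)) (∣-∣ℚ-sym q p) (half q p))
  where
  half : ∀ p q → ‖ p ‖ℚ ℚ.- ‖ q ‖ℚ ℚ.≤ ∣ p - q ∣ℚ
  half p q = p≤q+r⇒p-r≤q ‖ q ‖ℚ
    (ℚ.≤-trans (‖‖ℚ-minimal p (nearest q)) (∣-∣ℚ-triangle p q (ℤ⇒ℚ (nearest q))))

Eventually : Pred ℕ 0ℓ → Set
Eventually P = ∃ λ N → ∀ n → N ℕ.≤ n → P n

Eventually-map₂ : ∀ {P Q R : Pred ℕ 0ℓ} → (∀ n → P n → Q n → R n) →
                  Eventually P → Eventually Q → Eventually R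
Eventually-map₂ f (M , p) (N , q) = M ℕ.⊔ N , λ n M⊔N≤n →
  f n (p n (ℕ.m⊔n≤o⇒m≤o M N M⊔N≤n)) (q n (ℕ.m⊔n≤o⇒n≤o M N M⊔N≤n))

Cauchy : Pred (ℕ → ℚ) 0ℓ
Cauchy s = ∀ ε → 0ℚ ℚ.< ε →
  ∃ λ N → ∀ m n → N ℕ.≤ m → N ℕ.≤ n → ∣ s m - s n ∣ℚ ℚ.< ε

-- A Cauchy sequence of rationals; real numbers are these up to _≈_.
record ℝ : Set where
  constructor mkℝ
  field
    seq    : ℕ → ℚ
    cauchy : Cauchy seq

open ℝ public

infix 4 _≈_ _<_ _≤_

_≈_ : ℝ → ℝ → Set
x ≈ y = ∀ ε → 0ℚ ℚ.< ε → Eventually λ n → ∣ seq x n - seq y n ∣ℚ ℚ.< ε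

_<_ : ℝ → ℝ → Set
x < y = ∃ λ ε → 0ℚ ℚ.< ε × Eventually λ n → seq x n ℚ.+ ε ℚ.≤ seq y n

_≤_ : ℝ → ℝ → Set
x ≤ y = ∀ ε → 0ℚ ℚ.< ε → Eventually λ n → seq x n ℚ.≤ seq y n ℚ.+ ε

≈-setoid : Setoid 0ℓ 0ℓ
≈-setoid = record
  { Carrier       = ℝ
  ; _≈_           = _≈_
  ; isEquivalence = record
    { refl  = λ {x} ε ε>0 → 0 , λ n _ →
        subst (ℚ._< ε) (sym (cong ℚ.∣_∣ (ℚ.+-inverseʳ (seq x n)))) ε>0
    ; sym   = λ {x} {y} x≈y ε ε>0 → let N , h = x≈y ε ε>0 in
        N , λ n N≤n → subst (ℚ._< ε) (∣-∣ℚ-sym (seq x n) (seq y n)) (h n N≤n)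
    ; trans = λ {x} {y} {z} x≈y y≈z ε ε>0 → Eventually-map₂
        (λ n p q → ℚ.≤-<-trans (∣-∣ℚ-triangle (seq x n) (seq y n) (seq z n))
          (subst (_ ℚ.<_) (½ε+½ε ε) (ℚ.+-mono-< p q)))
        (x≈y (½ ℚ.* ε) (½ε>0 ε>0)) (y≈z (½ ℚ.* ε) (½ε>0 ε>0))
    }
  }

ℚ⇒ℝ : ℚ → ℝ
ℚ⇒ℝ q = mkℝ (λ _ → q) λ ε ε>0 → 0 , λ _ _ _ _ →
  subst (ℚ._< ε) (sym (cong ℚ.∣_∣ (ℚ.+-inverseʳ q))) ε>0

0ℝ : ℝ
0ℝ = ℚ⇒ℝ 0ℚ

liftNonexpansive : (f : ℚ → ℚ) → (∀ p q → ∣ f p - f q ∣ℚ ℚ.≤ ∣ p - q ∣ℚ) → ℝ → ℝ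
liftNonexpansive f f-ne x = mkℝ (f ∘ seq x) λ ε ε>0 → let N , h = cauchy x ε ε>0 in
  N , λ m n N≤m N≤n → ℚ.≤-<-trans (f-ne (seq x m) (seq x n)) (h m n N≤m N≤n)

infix  8 -_
infixl 6 _+_ _-_

_+_ : ℝ → ℝ → ℝ
x + y = mkℝ (λ n → seq x n ℚ.+ seq y n) λ ε ε>0 →
  let M , p = cauchy x (½ ℚ.* ε) (½ε>0 ε>0)
      N , q = cauchy y (½ ℚ.* ε) (½ε>0 ε>0)
  in M ℕ.⊔ N , λ m n h h′ → ℚ.≤-<-trans
       (ℚ.≤-trans
         (ℚ.≤-reflexive (cong ℚ.∣_∣
           (+-interchange-- (seq x m) (seq y m) (seq x n) (seq y n))))
         (ℚ.∣p+q∣≤∣p∣+∣q∣ (seq x m ℚ.- seq x n) (seq y m ℚ.- seq y n)))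
       (subst (_ ℚ.<_) (½ε+½ε ε) (ℚ.+-mono-<
         (p m n (ℕ.m⊔n≤o⇒m≤o M N h) (ℕ.m⊔n≤o⇒m≤o M N h′))
         (q m n (ℕ.m⊔n≤o⇒n≤o M N h) (ℕ.m⊔n≤o⇒n≤o M N h′))))

-_ : ℝ → ℝ
-_ = liftNonexpansive ℚ.-_ λ p q → ℚ.≤-reflexive
  (trans (cong ℚ.∣_∣ (neg-- p q)) (∣-∣ℚ-sym q p))

_-_ : ℝ → ℝ → ℝ
x - y = x + (- y)

∣_∣ : ℝ → ℝ
∣_∣ = liftNonexpansive ℚ.∣_∣ ∣∣p∣-∣q∣∣≤∣p-q∣

‖_‖ : ℝ → ℝ
‖_‖ = liftNonexpansive ‖_‖ℚ ∣‖p‖-‖q‖∣≤∣p-q∣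

+-rawMonoid : RawMonoid 0ℓ 0ℓ
+-rawMonoid = record { Carrier = ℝ ; _≈_ = _≈_ ; _∙_ = _+_ ; ε = 0ℝ }

open RawMonoidOps +-rawMonoid public using () renaming (_×_ to infixr 8 _·_)

record IsInfimum {I : Set} (f : I → ℝ) (m : ℝ) : Set where
  field
    lowerBound : ∀ i → m ≤ f i
    greatest   : ∀ l → (∀ i → l ≤ f i) → l ≤ m

-- ‖ t ‖, although computed termwise, is the distance from t to ℤ.
‖‖-isInfimum : ∀ t → IsInfimum (λ (k : ℤ) → ∣ t - ℚ⇒ℝ (ℤ⇒ℚ k) ∣) ‖ t ‖
‖‖-isInfimum t = record
  { lowerBound = λ k ε ε>0 → 0 , λ n _ →
      ℚ.≤-trans (‖‖ℚ-minimal (seq t n) k) (≤+ε ε>0)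
  ; greatest   = λ l l≤ ε ε>0 →
      let δ = ½ ℚ.* ε ; η = ½ ℚ.* δ
          δ>0 = ½ε>0 ε>0 ; η>0 = ½ε>0 δ>0
          N , h  = cauchy t η η>0
          k      = nearest (seq t N)
          M , h′ = l≤ k δ δ>0
      in N ℕ.⊔ M , λ n N⊔M≤n →
        let tₙ = seq t n ; tN = seq t N ; κ = ℤ⇒ℚ k
            close = h n N (ℕ.m⊔n≤o⇒m≤o N M N⊔M≤n) ℕ.≤-refl
            close′ = subst (ℚ._< η) (∣-∣ℚ-sym tₙ tN) close
        in begin
          seq l n                             ≤⟨ h′ n (ℕ.m⊔n≤o⇒n≤o N M N⊔M≤n) ⟩
          ∣ tₙ - κ ∣ℚ ℚ.+ δ                   ≤⟨ ℚ.+-monoˡ-≤ δ (∣-∣ℚ-triangle tₙ tN κ) ⟩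
          ∣ tₙ - tN ∣ℚ ℚ.+ ‖ tN ‖ℚ ℚ.+ δ      ≤⟨ ℚ.+-monoˡ-≤ δ (ℚ.+-mono-≤ (ℚ.<⇒≤ close)
              (ℚ.≤-trans (‖‖ℚ-minimal tN (nearest tₙ)) (∣-∣ℚ-triangle tN tₙ _))) ⟩
          η ℚ.+ (∣ tN - tₙ ∣ℚ ℚ.+ ‖ tₙ ‖ℚ) ℚ.+ δ
                                              ≤⟨ ℚ.+-monoˡ-≤ δ (ℚ.+-monoʳ-≤ η
                                                   (ℚ.+-monoˡ-≤ ‖ tₙ ‖ℚ (ℚ.<⇒≤ close′))) ⟩
          η ℚ.+ (η ℚ.+ ‖ tₙ ‖ℚ) ℚ.+ δ         ≡⟨ cong (ℚ._+ δ) (ℚ.+-assoc η η ‖ tₙ ‖ℚ) ⟨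
          η ℚ.+ η ℚ.+ ‖ tₙ ‖ℚ ℚ.+ δ           ≡⟨ cong (λ z → z ℚ.+ ‖ tₙ ‖ℚ ℚ.+ δ) (½ε+½ε δ) ⟩
          δ ℚ.+ ‖ tₙ ‖ℚ ℚ.+ δ                 ≡⟨ cong (ℚ._+ δ) (ℚ.+-comm δ ‖ tₙ ‖ℚ) ⟩
          ‖ tₙ ‖ℚ ℚ.+ δ ℚ.+ δ                 ≡⟨ ℚ.+-assoc ‖ tₙ ‖ℚ δ δ ⟩
          ‖ tₙ ‖ℚ ℚ.+ (δ ℚ.+ δ)               ≡⟨ cong (‖ tₙ ‖ℚ ℚ.+_) (½ε+½ε ε) ⟩
          ‖ tₙ ‖ℚ ℚ.+ ε                       ∎
  }
  where
  open ℚ.≤-Reasoning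
  ≤+ε : ∀ {p ε} → 0ℚ ℚ.< ε → p ℚ.≤ p ℚ.+ ε
  ≤+ε {p} {ε} ε>0 = subst (ℚ._≤ p ℚ.+ ε) (ℚ.+-identityʳ p) (ℚ.+-monoʳ-≤ p (ℚ.<⇒≤ ε>0))

ℕ⁺ : Set
ℕ⁺ = ∃ NonZero

Rational : Pred ℝ 0ℓ
Rational x = ∃ λ q → x ≈ ℚ⇒ℝ q

Bad : Pred ℝ 0ℓ
Bad x = ∃ λ m → IsInfimum (λ ((n , _) : ℕ⁺) → n · ‖ n · x ‖) m × 0ℝ < m

WA : Pred ℝ 0ℓ
WA = ∁ Bad

partialSum : (ℕ → ℝ) → ℕ → ℝ
partialSum ψ zero    = 0ℝ
partialSum ψ (suc N) = partialSum ψ N + ψ (suc N)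

-- A function on the positive integers is represented by one on ℕ whose
-- value at 0 is never consulted.
record 𝒟 (ψ : ℕ → ℝ) : Set where
  field
    nonNegative   : ∀ n → 1 ℕ.≤ n → 0ℝ ≤ ψ n
    nonIncreasing : ∀ m n → 1 ℕ.≤ m → m ℕ.≤ n → ψ n ≤ ψ m
    divergent     : ∀ B → Eventually λ N → B < partialSum ψ N

W : (ℕ → ℝ) → Pred (ℝ × ℝ) 0ℓ
W ψ (x , y) = ∀ N → ∃ λ n → N ℕ.< n × ‖ n · x + y ‖ < ψ n

Π : Pred (ℝ × ℝ) 0ℓ
Π p = ∀ ψ → ψ ∈ 𝒟 → p ∈ W ψ

Φ : ℝ → Pred ℝ 0ℓ
Φ x y = (x , y) ∈ Π

subsetoid : Pred ℝ 0ℓ → Setoid 0ℓ 0ℓ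
subsetoid P = On.setoid {B = ∃ P} ≈-setoid proj₁

infix 4 #_≡_

-- Cardinals are given by representatives, and two reals count as one
-- when they are related by _≈_.
#_≡_ : Pred ℝ 0ℓ → Setoid 0ℓ 0ℓ → Set
# P ≡ κ = Bijection (subsetoid P) κ

0# ℵ₀ 2^ℵ₀ : Setoid 0ℓ 0ℓ
0#   = ≡.setoid ⊥
ℵ₀   = ≡.setoid ℕ
2^ℵ₀ = ℕ →-setoid Bool

{-# OPTIONS --safe #-}

-- Put D n = ‖ n x + y ‖. Since every ψ ∈ 𝒟 is non-increasing, y ∈ Φ x fails exactly when the
-- running minimum of D over n > M, for some M, has a divergent sum.
--
-- x badly approximable, κ + κ ≤ n ‖ n x ‖: if a < a + d are consecutive minima of D, then
-- ‖ d x ‖ ≤ D a + D (a + d) ≤ 2 D a, so d · D a ≥ κ, and this is what the sum gains between them.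
-- x rational, d x ∈ ℤ: D is bounded below by a positive constant unless d y ∈ ℤ, and D vanishes
-- infinitely often if y ∈ ℤ.
-- x irrational and well approximable: there are q i with θ i = q i x - p i and Σ q i ∣ θ i ∣ < ∞,
-- and ∣ θ i ∣ can be made to decrease as fast as wished. Every choice of c i ∈ {1 , 2} yields a
-- different y = - Σ c i θ i. With m i = Σ_{j < i} c j q j, D (m i) is at most 4 ∣ θ i ∣, so the sum
-- of a non-increasing minorant of D gains at most 8 q i ∣ θ i ∣ between m i and m (i + 1).
--
-- The cardinalities follow from injections in both directions by the Schröder–Bernstein theorem.
module Submission where

open import Defs
open import Axiom.ExcludedMiddle using (ExcludedMiddle)
open import Data.Bool.Base using (Bool; true; false)
open import Data.Empty using (⊥; ⊥-elim)
open import Data.Integer.Base as ℤ using (ℤ; +_; -[1+_])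
import Data.Integer.Properties as ℤ
open import Data.Nat.Base as ℕ using (ℕ; zero; suc; z≤n; s≤s)
import Data.Nat.Properties as ℕ
open import Data.Product.Base using (∃; _×_; _,_; proj₁; proj₂)
open import Data.Rational.Base as ℚ using (ℚ; 0ℚ; 1ℚ; ½; floor; mkℚ)
import Data.Rational.Properties as ℚ
open import Data.Rational.Solver using (module +-*-Solver)
import Data.Rational.Unnormalised.Base as ℚᵘ
import Data.Rational.Unnormalised.Properties as ℚᵘ
open import Data.Sum.Base using (_⊎_; inj₁; inj₂; [_,_]′)
open import Function.Base using (case_of_; _∘_)
open import Function.Bundles using (Bijection; Injection; mk⇔)
open import Level using (0ℓ)
open import Relation.Binary.Bundles using (Setoid)
open import Relation.Binary.Definitions using (tri<; tri≈; tri>)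
open import Relation.Binary.PropositionalEquality
  using (_≡_; _≢_; refl; sym; trans; cong; cong₂; subst; subst₂)
open import Relation.Binary.Structures using (IsPreorder)
open import Relation.Nullary using (¬_; Dec; yes; no)
open import Relation.Nullary.Decidable using (does; does-⇔)
open import Relation.Unary using (Pred; _∈_; _∉_)

open +-*-Solver using (solve; _:=_; _:+_; _:-_; _:*_; :-_; con)
open Setoid ≈-setoid using () renaming
  (refl to ≈-refl; sym to ≈-sym; trans to ≈-trans; isEquivalence to ≈-isEquivalence)

-- In the badly approximable case the wait for the next minimum must end, and this requires D > 0:
-- only a positive value exceeds every bound when repeated. Two zeros of D would contradict the
-- separation of small values, so M is chosen past the only possible one. In the well approximable
-- case the digits are 1 and 2 because the index m i has to grow at every step; a digit 0 could
-- leave it in place for ever. The approximations obey two separate conditions: 8 |θ (i + 1)| < |θ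
-- i| keeps different digit sequences apart, and the halving of q i |θ i| bounds the sum. No series
-- is summed: y is the infimum of the upper ends of nested intervals, and a potential that never
-- increases replaces the geometric series. Infima are also needed at the entrance: `Bad` asks for
-- one to exist, so x ∈ `WA` yields small values of n ‖ n x ‖ only after every bounded family is
-- known to have an infimum.

private variable
  x y z u v : ℝ
  a b c d ε : ℚ

-- Ordered group structure of the reals

-- Reduces a linear inequality to a ring identity for the solver: the given inequality is usually a
-- sum of several hypotheses, and only the differences of the two sides have to agree. Most
-- ε-estimates on terms take this form.
ℚ-≤-by-difference : a ℚ.≤ b → d ℚ.- c ≡ b ℚ.- a → c ℚ.≤ d
ℚ-≤-by-difference {a} {b} {d} {c} a≤b eq = subst₂ ℚ._≤_
  (solve 2 (λ a c → a :+ (c :- a) := c) refl a c)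
  (trans (solve 3 (λ a b c → b :+ (c :- a) := (b :- a) :+ c) refl a b c)
    (trans (cong (ℚ._+ c) (sym eq)) (p-q+q d c)))
  (ℚ.+-monoˡ-≤ (c ℚ.- a) a≤b)

ℚ-<-by-difference : a ℚ.< b → d ℚ.- c ≡ b ℚ.- a → c ℚ.< d
ℚ-<-by-difference {a} {b} {d} {c} a<b eq = subst₂ ℚ._<_
  (solve 2 (λ a c → a :+ (c :- a) := c) refl a c)
  (trans (solve 3 (λ a b c → b :+ (c :- a) := (b :- a) :+ c) refl a b c)
    (trans (cong (ℚ._+ c) (sym eq)) (p-q+q d c)))
  (ℚ.+-monoˡ-< (c ℚ.- a) a<b)

∣p-q∣≤r⇒p≤q+r : ℚ.∣ a ℚ.- b ∣ ℚ.≤ c → a ℚ.≤ b ℚ.+ c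
∣p-q∣≤r⇒p≤q+r {a} {b} {c} h = subst (a ℚ.≤_) (ℚ.+-comm c b)
  (p-r≤q⇒p≤q+r b (ℚ.≤-trans (p≤∣p∣ (a ℚ.- b)) h))

p≤q+r,q≤p+r⇒∣p-q∣≤r : a ℚ.≤ b ℚ.+ c → b ℚ.≤ a ℚ.+ c → ℚ.∣ a ℚ.- b ∣ ℚ.≤ c
p≤q+r,q≤p+r⇒∣p-q∣≤r {a} {b} {c} h h′ = ∣p∣≤
  (p≤q+r⇒p-r≤q b (subst (a ℚ.≤_) (ℚ.+-comm b c) h))
  (subst (ℚ._≤ c) (sym (neg-diff a b)) (p≤q+r⇒p-r≤q a (subst (b ℚ.≤_) (ℚ.+-comm a c) h′)))

½ε<ε : 0ℚ ℚ.< ε → ½ ℚ.* ε ℚ.< ε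
½ε<ε {ε} ε>0 = ℚ-<-by-difference (½ε>0 ε>0)
  (solve 1 (λ ε → ε :- con ½ :* ε := con ½ :* ε :- con 0ℚ) refl ε)

Eventually-map : ∀ {P Q : ℕ → Set} → (∀ n → P n → Q n) → Eventually P → Eventually Q
Eventually-map f (N , p) = N , λ n N≤n → f n (p n N≤n)

pointwise-≈ : (∀ n → seq x n ≡ seq y n) → x ≈ y
pointwise-≈ {x} {y} eq ε ε>0 = 0 , λ n _ → subst (ℚ._< ε)
  (sym (cong ℚ.∣_∣ (trans (cong (ℚ._- seq y n) (eq n)) (ℚ.+-inverseʳ (seq y n))))) ε>0

pointwise-≤ : (∀ n → seq x n ℚ.≤ seq y n) → x ≤ y
pointwise-≤ {x} {y} h ε ε>0 = 0 , λ n _ → ℚ.≤-trans (h n)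
  (ℚ-≤-by-difference (ℚ.<⇒≤ ε>0) (solve 2 (λ y ε → y :+ ε :- y := ε :- con 0ℚ) refl (seq y n) ε))

-- The equation is asked of the terms, where the solver for ℚ applies.
≤-by-difference : ∀ (x y a b : ℝ) → x ≤ y → (∀ n → seq b n ℚ.- seq a n ≡ seq y n ℚ.- seq x n) → a ≤
    b
≤-by-difference x y a b x≤y eq ε ε>0 = Eventually-map
  (λ n h → ℚ-≤-by-difference h (trans
    (solve 3 (λ a b ε → b :+ ε :- a := b :- a :+ ε) refl (seq a n) (seq b n) ε)
    (trans (cong (ℚ._+ ε) (eq n))
      (solve 3 (λ x y ε → y :- x :+ ε := y :+ ε :- x) refl (seq x n) (seq y n) ε))))
  (x≤y ε ε>0)

≤-refl : x ≤ x
≤-refl {x} = pointwise-≤ {x} {x} λ _ → ℚ.≤-refl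

≤-trans : x ≤ y → y ≤ z → x ≤ z
≤-trans {x} {y} {z} x≤y y≤z ε ε>0 = Eventually-map₂
  (λ n p q → ℚ.≤-trans p (ℚ-≤-by-difference q
    (solve 3 (λ y z ε → z :+ ε :- (y :+ con ½ :* ε) := z :+ con ½ :* ε :- y) refl (seq y n)
        (seq z n) ε)))
  (x≤y (½ ℚ.* ε) (½ε>0 ε>0)) (y≤z (½ ℚ.* ε) (½ε>0 ε>0))

≈⇒≤ : x ≈ y → x ≤ y
≈⇒≤ x≈y ε ε>0 = Eventually-map (λ n h → ∣p-q∣≤r⇒p≤q+r (ℚ.<⇒≤ h)) (x≈y ε ε>0)

≤-antisym : x ≤ y → y ≤ x → x ≈ y
≤-antisym x≤y y≤x ε ε>0 = Eventually-map₂
  (λ n p q → ℚ.≤-<-trans (p≤q+r,q≤p+r⇒∣p-q∣≤r p q) (½ε<ε ε>0))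
  (x≤y (½ ℚ.* ε) (½ε>0 ε>0)) (y≤x (½ ℚ.* ε) (½ε>0 ε>0))

≤-isPreorder : IsPreorder _≈_ _≤_
≤-isPreorder = record
  { isEquivalence = ≈-isEquivalence
  ; reflexive     = λ {x} {y} → ≈⇒≤ {x} {y}
  ; trans         = λ {x} {y} {z} → ≤-trans {x} {y} {z}
  }

<⇒≤ : x < y → x ≤ y
<⇒≤ {x} {y} (δ , δ>0 , h) ε ε>0 = Eventually-map
  (λ n p → ℚ-≤-by-difference (ℚ.+-mono-≤ p (ℚ.+-mono-≤ (ℚ.<⇒≤ δ>0) (ℚ.<⇒≤ ε>0)))
    (solve 4 (λ x y δ ε → y :+ ε :- x := (y :+ (δ :+ ε)) :- (x :+ δ :+ (con 0ℚ :+ con 0ℚ))) refl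
      (seq x n) (seq y n) δ ε)) h

<-≤-trans : x < y → y ≤ z → x < z
<-≤-trans {x} {y} {z} (ε , ε>0 , h) y≤z = ½ ℚ.* ε , ½ε>0 ε>0 , Eventually-map₂
  (λ n p q → ℚ-≤-by-difference (ℚ.+-mono-≤ p q)
    (solve 4 (λ x y z ε → z :- (x :+ con ½ :* ε) := y :+ (z :+ con ½ :* ε) :- (x :+ ε :+ y)) refl
      (seq x n) (seq y n) (seq z n) ε))
  h (y≤z (½ ℚ.* ε) (½ε>0 ε>0))

≤-<-trans : x ≤ y → y < z → x < z
≤-<-trans {x} {y} {z} x≤y (ε , ε>0 , h) = ½ ℚ.* ε , ½ε>0 ε>0 , Eventually-map₂
  (λ n p q → ℚ-≤-by-difference (ℚ.+-mono-≤ p q)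
    (solve 4 (λ x y z ε → z :- (x :+ con ½ :* ε) := y :+ con ½ :* ε :+ z :- (x :+ (y :+ ε))) refl
      (seq x n) (seq y n) (seq z n) ε))
  (x≤y (½ ℚ.* ε) (½ε>0 ε>0)) h

<-trans : x < y → y < z → x < z
<-trans {x} {y} {z} x<y y<z = <-≤-trans {x} {y} {z} x<y (<⇒≤ {y} {z} y<z)

<-irrefl : ¬ x < x
<-irrefl {x} (ε , ε>0 , N , h) = ℚ.<-irrefl refl (ℚ.<-≤-trans ε>0
  (ℚ-≤-by-difference (h N ℕ.≤-refl)
    (solve 2 (λ x ε → con 0ℚ :- ε := x :- (x :+ ε)) refl (seq x N) ε)))

<-≤-⊥ : x < y → y ≤ x → ⊥
<-≤-⊥ {x} {y} x<y y≤x = <-irrefl {x} (<-≤-trans {x} {y} {x} x<y y≤x)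

module ≤-Reasoning where
  open import Relation.Binary.Reasoning.Base.Triple ≤-isPreorder
    (λ {x} {y} x<y y<x → <-≤-⊥ {x} {y} x<y (<⇒≤ {y} {x} y<x))
    (λ {x} {y} {z} → <-trans {x} {y} {z})
    ( (λ {x} {y} {z} y≈z x<y → <-≤-trans {x} {y} {z} x<y (≈⇒≤ {y} {z} y≈z))
    , (λ {x} {y} {z} y≈z y<x → ≤-<-trans {z} {y} {x} (≈⇒≤ {z} {y} (≈-sym {y} {z} y≈z)) y<x))
    (λ {x} {y} → <⇒≤ {x} {y})
    (λ {x} {y} {z} → <-≤-trans {x} {y} {z})
    (λ {x} {y} {z} → ≤-<-trans {x} {y} {z})
    public

+-mono-≤ : x ≤ y → u ≤ v → x + u ≤ y + v
+-mono-≤ {x} {y} {u} {v} x≤y u≤v ε ε>0 = Eventually-map₂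
  (λ n p q → ℚ-≤-by-difference (ℚ.+-mono-≤ p q)
    (solve 5 (λ x y u v ε → y :+ v :+ ε :- (x :+ u) :=
        (y :+ con ½ :* ε) :+ (v :+ con ½ :* ε) :- (x :+ u)) refl
      (seq x n) (seq y n) (seq u n) (seq v n) ε))
  (x≤y (½ ℚ.* ε) (½ε>0 ε>0)) (u≤v (½ ℚ.* ε) (½ε>0 ε>0))

+-mono-<-≤ : x < y → u ≤ v → x + u < y + v
+-mono-<-≤ {x} {y} {u} {v} (ε , ε>0 , h) u≤v = ½ ℚ.* ε , ½ε>0 ε>0 , Eventually-map₂
  (λ n p q → ℚ-≤-by-difference (ℚ.+-mono-≤ p q)
    (solve 5 (λ x y u v ε → y :+ v :- (x :+ u :+ con ½ :* ε) :=
        y :+ (v :+ con ½ :* ε) :- (x :+ ε :+ u)) refl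
      (seq x n) (seq y n) (seq u n) (seq v n) ε))
  h (u≤v (½ ℚ.* ε) (½ε>0 ε>0))

+-cong : x ≈ y → u ≈ v → x + u ≈ y + v
+-cong {x} {y} {u} {v} x≈y u≈v = ≤-antisym {x + u} {y + v}
  (+-mono-≤ {x} {y} {u} {v} (≈⇒≤ {x} {y} x≈y) (≈⇒≤ {u} {v} u≈v))
  (+-mono-≤ {y} {x} {v} {u} (≈⇒≤ {y} {x} (≈-sym {x} {y} x≈y)) (≈⇒≤ {v} {u} (≈-sym {u} {v} u≈v)))

seq-near : ∀ x → 0ℚ ℚ.< ε → ∃ λ N → ∀ k n → N ℕ.≤ k → N ℕ.≤ n →
           seq x n ℚ.≤ seq x k ℚ.+ ε
seq-near x ε>0 = let N , h = cauchy x _ ε>0 in N , λ k n N≤k N≤n →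
  ∣p-q∣≤r⇒p≤q+r (ℚ.<⇒≤ (h n k N≤n N≤k))

-- An abstract eighth keeps the nested halvings hidden: the error budgets below become linear in one
-- variable.
∃-eighth : ∀ ε → 0ℚ ℚ.< ε → ∃ λ δ → 0ℚ ℚ.< δ ×
  let ε/4 = δ ℚ.+ δ ; ε/2 = ε/4 ℚ.+ ε/4 in ε/2 ℚ.+ ε/2 ≡ ε
∃-eighth ε ε>0 =
  let ε/8 = ½ ℚ.* (½ ℚ.* (½ ℚ.* ε))
      ε/4≡ = ½ε+½ε (½ ℚ.* (½ ℚ.* ε)) ; ε/2≡ = ½ε+½ε (½ ℚ.* ε)
  in ε/8 , ½ε>0 (½ε>0 (½ε>0 ε>0)) ,
     trans (cong (λ t → (t ℚ.+ t) ℚ.+ (t ℚ.+ t)) ε/4≡) (trans (cong (λ t → t ℚ.+ t) ε/2≡) (½ε+½ε ε))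

-- Approximate comparison needs no excluded middle: one term of each sequence, taken where both vary
-- by at most θ, is compared with the threshold 4θ. Above it x stays 2θ ahead of y; below it x
-- exceeds y by at most 6θ, within the budget ε = 8θ.
<-or-≤ε : ∀ x y ε → 0ℚ ℚ.< ε → y < x ⊎ Eventually λ n → seq x n ℚ.≤ seq y n ℚ.+ ε
<-or-≤ε x y ε ε>0 =
  let θ , θ>0 , 8θ≡ε = ∃-eighth ε ε>0
      M , p = seq-near x θ>0
      N , q = seq-near y θ>0
  in subst (λ ε → y < x ⊎ Eventually λ n → seq x n ℚ.≤ seq y n ℚ.+ ε) 8θ≡ε
       (by-cases θ θ>0 M p N q (ℚ.≤-total (seq x (M ℕ.⊔ N)) _))
  where
  by-cases : ∀ θ → 0ℚ ℚ.< θ →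
    ∀ M → (∀ k n → M ℕ.≤ k → M ℕ.≤ n → seq x n ℚ.≤ seq x k ℚ.+ θ) →
    ∀ N → (∀ k n → N ℕ.≤ k → N ℕ.≤ n → seq y n ℚ.≤ seq y k ℚ.+ θ) →
    let K = M ℕ.⊔ N ; η = θ ℚ.+ θ ; δ = η ℚ.+ η in
    seq x K ℚ.≤ seq y K ℚ.+ δ ⊎ seq y K ℚ.+ δ ℚ.≤ seq x K →
    y < x ⊎ Eventually λ n → seq x n ℚ.≤ seq y n ℚ.+ (δ ℚ.+ δ)
  by-cases θ θ>0 M p N q (inj₁ h) = inj₂ (M ℕ.⊔ N , λ n K≤n → ℚ-≤-by-difference
    (ℚ.+-mono-≤ (ℚ.+-mono-≤ h (ℚ.+-mono-≤
        (p _ n (ℕ.m≤m⊔n M N) (ℕ.≤-trans (ℕ.m≤m⊔n M N) K≤n))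
        (q n _ (ℕ.≤-trans (ℕ.m≤n⊔m M N) K≤n) (ℕ.m≤n⊔m M N))))
      (ℚ.+-mono-≤ (ℚ.<⇒≤ θ>0) (ℚ.<⇒≤ θ>0)))
    (solve 5 (λ x y xK yK θ → let η = θ :+ θ ; δ = η :+ η in
       y :+ (δ :+ δ) :- x := (yK :+ δ) :+ ((xK :+ θ) :+ (y :+ θ))
         :+ (θ :+ θ) :- ((xK :+ (x :+ yK)) :+ (con 0ℚ :+ con 0ℚ)))
       refl (seq x n) (seq y n) (seq x (M ℕ.⊔ N)) (seq y (M ℕ.⊔ N)) θ))
  by-cases θ θ>0 M p N q (inj₂ h) =
    inj₁ (θ ℚ.+ θ , ℚ.+-mono-< θ>0 θ>0 , M ℕ.⊔ N , λ n K≤n → ℚ-≤-by-difference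
    (ℚ.+-mono-≤ h (ℚ.+-mono-≤
      (p n _ (ℕ.≤-trans (ℕ.m≤m⊔n M N) K≤n) (ℕ.m≤m⊔n M N))
      (q _ n (ℕ.m≤n⊔m M N) (ℕ.≤-trans (ℕ.m≤n⊔m M N) K≤n))))
    (solve 5 (λ x y xK yK θ → let η = θ :+ θ in
       x :- (y :+ η) :=
         xK :+ ((x :+ θ) :+ (yK :+ θ)) :- ((yK :+ (η :+ η)) :+ (xK :+ y)))
       refl (seq x n) (seq y n) (seq x (M ℕ.⊔ N)) (seq y (M ℕ.⊔ N)) θ))

≮⇒≥ : ¬ y < x → x ≤ y
≮⇒≥ {y} {x} y≮x ε ε>0 = [ (λ y<x → ⊥-elim (y≮x y<x)) , (λ h → h) ]′ (<-or-≤ε x y ε ε>0)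

<-dense : x < y → ∃ λ q → x < ℚ⇒ℝ q × ℚ⇒ℝ q < y
<-dense {x} {y} (ε , ε>0 , M , h) =
  let η , η>0 , 8η≡ε = ∃-eighth ε ε>0
      N , near = seq-near x η>0
  in between η η>0 8η≡ε N near
  where
  between : ∀ η → 0ℚ ℚ.< η → let δ = η ℚ.+ η in (δ ℚ.+ δ) ℚ.+ (δ ℚ.+ δ) ≡ ε →
    ∀ N → (∀ k n → N ℕ.≤ k → N ℕ.≤ n → seq x n ℚ.≤ seq x k ℚ.+ η) →
    ∃ λ q → x < ℚ⇒ℝ q × ℚ⇒ℝ q < y
  between η η>0 8η≡ε N near =
    let K = M ℕ.⊔ N ; M≤K = ℕ.m≤m⊔n M N ; N≤K = ℕ.m≤n⊔m M N
        0≤2η = ℚ.+-mono-≤ (ℚ.<⇒≤ η>0) (ℚ.<⇒≤ η>0)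
    -- The gap between x and y is at least 8η, and later terms of x lie within η of the one at K. A
    -- point 2η above that term exceeds x by at least η and stays at least 5η below y.
    in seq x K ℚ.+ (η ℚ.+ η)
     , (η , η>0 , K , λ n K≤n → ℚ-≤-by-difference (near K n N≤K (ℕ.≤-trans N≤K K≤n))
         (solve 3 (λ x xK η → xK :+ (η :+ η) :- (x :+ η) := xK :+ η :- x) refl (seq x n) (seq x K)
             η))
     , (η , η>0 , K , λ n K≤n → ℚ-≤-by-difference
         (ℚ.+-mono-≤ (near n K (ℕ.≤-trans N≤K K≤n) N≤K) (ℚ.+-mono-≤
           (subst (λ ε → seq x n ℚ.+ ε ℚ.≤ seq y n) (sym 8η≡ε) (h n (ℕ.≤-trans M≤K K≤n)))
           (ℚ.+-mono-≤ 0≤2η 0≤2η)))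
         (solve 4 (λ x xK y η → let δ = η :+ η ; 0+0 = con 0ℚ :+ con 0ℚ in
           y :- (xK :+ δ :+ η) := (x :+ η) :+ (y :+ (δ :+ δ)) :-
             (xK :+ ((x :+ ((δ :+ δ) :+ (δ :+ δ))) :+ (0+0 :+ 0+0))))
           refl (seq x n) (seq x K) (seq y n) η))

-- Rational bounds, integer multiples and the Archimedean property

ℚ⇒ℝ-mono-≤ : a ℚ.≤ b → ℚ⇒ℝ a ≤ ℚ⇒ℝ b
ℚ⇒ℝ-mono-≤ {a} {b} a≤b = pointwise-≤ {ℚ⇒ℝ a} {ℚ⇒ℝ b} λ _ → a≤b

ℚ⇒ℝ-mono-< : a ℚ.< b → ℚ⇒ℝ a < ℚ⇒ℝ b
ℚ⇒ℝ-mono-< {a} {b} a<b =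
  b ℚ.- a , ℚ-<-by-difference a<b (solve 2 (λ a b → b :- a :- con 0ℚ := b :- a) refl a b) ,
  0 , λ _ _ → ℚ.≤-reflexive (solve 2 (λ a b → a :+ (b :- a) := b) refl a b)

ℚ⇒ℝ-cancel-< : ℚ⇒ℝ a < ℚ⇒ℝ b → a ℚ.< b
ℚ⇒ℝ-cancel-< {a} (ε , ε>0 , N , h) = ℚ.<-≤-trans
  (ℚ-<-by-difference ε>0 (solve 2 (λ a ε → a :+ ε :- a := ε :- con 0ℚ) refl a ε)) (h N ℕ.≤-refl)

0<x⇒0<q<x : 0ℝ < x → ∃ λ q → 0ℚ ℚ.< q × ℚ⇒ℝ q < x
0<x⇒0<q<x {x} 0<x = let q , 0<q , q<x = <-dense {0ℝ} {x} 0<x in q , ℚ⇒ℝ-cancel-< 0<q , q<x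

∃-upper-bound : ∀ x → ∃ λ q → x ≤ ℚ⇒ℝ q
∃-upper-bound x = let N , near = seq-near x (ℚ.positive⁻¹ ½) in
  seq x N ℚ.+ ½ , λ ε ε>0 → N , λ n N≤n → ℚ-≤-by-difference
    (ℚ.+-mono-≤ (near N n ℕ.≤-refl N≤n) (ℚ.<⇒≤ ε>0))
    (solve 4 (λ x y ε ½ → y :+ ½ :+ ε :- x := y :+ ½ :+ ε :- (x :+ con 0ℚ))
      refl (seq x n) (seq x N) ε ½)

-- A copy of _·_ with its own head symbol: comparing two terms built with _·_ may unfold the
-- Cauchy proofs of the reals in them.
infixr 8 _•_
_•_ : ℕ → ℝ → ℝ
zero  • x = 0ℝ
suc n • x = x + n • x

•≡· : ∀ n x → n • x ≡ n · x
•≡· zero    x = refl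
•≡· (suc n) x = cong (λ t → x + t) (•≡· n x)

seq-• : ∀ n x k → seq (n • x) k ≡ ℤ⇒ℚ (+ n) ℚ.* seq x k
seq-• zero    x k = sym (ℚ.*-zeroˡ (seq x k))
seq-• (suc n) x k = trans (cong (seq x k ℚ.+_) (seq-• n x k))
  (trans (solve 2 (λ n q → q :+ n :* q := (n :+ con 1ℚ) :* q) refl (ℤ⇒ℚ (+ n)) (seq x k))
    (cong (ℚ._* seq x k) (sym (ℤ⇒ℚ-suc (+ n)))))

•-distrib-+ : ∀ x y n → n • (x + y) ≈ n • x + n • y
•-distrib-+ x y n = pointwise-≈ {n • (x + y)} {n • x + n • y} λ k → trans (seq-• n (x + y) k)
  (trans (ℚ.*-distribˡ-+ (ℤ⇒ℚ (+ n)) (seq x k) (seq y k))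
      (sym (cong₂ ℚ._+_ (seq-• n x k) (seq-• n y k))))

•-congʳ : ∀ n → x ≈ y → n • x ≈ n • y
•-congʳ         zero    x≈y = ≈-refl {0ℝ}
•-congʳ {x} {y} (suc n) x≈y = +-cong {x} {y} {n • x} {n • y} x≈y (•-congʳ {x} {y} n x≈y)

•-homo-+ : ∀ x m n → (m ℕ.+ n) • x ≈ m • x + n • x
•-homo-+ x zero    n = pointwise-≈ {n • x} {0ℝ + n • x} λ k → sym (ℚ.+-identityˡ (seq (n • x) k))
•-homo-+ x (suc m) n = begin-equality
  x + (m ℕ.+ n) • x
      ≈⟨ +-cong {x} {x} {(m ℕ.+ n) • x} {m • x + n • x} (≈-refl {x}) (•-homo-+ x m n) ⟩
  x + (m • x + n • x)   ≈⟨ pointwise-≈ {x + (m • x + n • x)} {x + m • x + n • x}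
                             (λ k → sym (ℚ.+-assoc (seq x k) (seq (m • x) k) (seq (n • x) k))) ⟩
  x + m • x + n • x     ∎
  where open ≤-Reasoning

•-assocˡ : ∀ x m n → m • (n • x) ≈ (m ℕ.* n) • x
•-assocˡ x zero    n = ≈-refl {0ℝ}
•-assocˡ x (suc m) n = begin-equality
  n • x + m • (n • x)
      ≈⟨ +-cong {n • x} {n • x} {m • (n • x)} {(m ℕ.* n) • x} (≈-refl {n • x}) (•-assocˡ x m n) ⟩
  n • x + (m ℕ.* n) • x   ≈⟨ •-homo-+ x n (m ℕ.* n) ⟨
  (suc m ℕ.* n) • x       ∎
  where open ≤-Reasoning

≤∣_∣ℤ : ∀ i → i ℤ.≤ + ℤ.∣ i ∣
≤∣ + n ∣ℤ      = ℤ.≤-refl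
≤∣ -[1+ n ] ∣ℤ = ℤ.-≤+

ℚ-archimedean : ∀ b c → 0ℚ ℚ.< c → ∃ λ n → b ℚ.≤ ℤ⇒ℚ (+ n) ℚ.* c
-- The absolute value matters only for negative b, where the integer above b / c may be negative;
-- enlarging it is harmless since c > 0.
ℚ-archimedean b c 0<c = ℤ.∣ ℤ.suc (floor b/c) ∣ , (begin
  b                                     ≡⟨ ℚ.*-identityʳ b ⟨
  b ℚ.* 1ℚ                              ≡⟨ cong (b ℚ.*_) (ℚ.*-inverseˡ c) ⟨
  b ℚ.* (ℚ.1/ c ℚ.* c)                  ≡⟨ ℚ.*-assoc b (ℚ.1/ c) c ⟨
  b/c ℚ.* c                             ≤⟨ ℚ.*-monoʳ-≤-nonNeg c (ℚ.<⇒≤ (<1+floor b/c)) ⟩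
  ℤ⇒ℚ (ℤ.suc (floor b/c)) ℚ.* c
      ≤⟨ ℚ.*-monoʳ-≤-nonNeg c (ℤ⇒ℚ-mono-≤ ≤∣ ℤ.suc (floor b/c) ∣ℤ) ⟩
  ℤ⇒ℚ (+ ℤ.∣ ℤ.suc (floor b/c) ∣) ℚ.* c ∎)
  where
  instance
    _ = ℚ.positive 0<c
    _ = ℚ.pos⇒nonZero c
    _ = ℚ.pos⇒nonNeg c
  b/c = b ℚ.* ℚ.1/ c
  open ℚ.≤-Reasoning

•-monoʳ-≤ : ∀ n → x ≤ y → n • x ≤ n • y
•-monoʳ-≤         zero    x≤y = ≤-refl {0ℝ}
•-monoʳ-≤ {x} {y} (suc n) x≤y = +-mono-≤ {x} {y} {n • x} {n • y} x≤y (•-monoʳ-≤ {x} {y} n x≤y)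

0≤n•x : ∀ n → 0ℝ ≤ x → 0ℝ ≤ n • x
0≤n•x         zero    0≤x = ≤-refl {0ℝ}
0≤n•x {x} (suc n) 0≤x = +-mono-≤ {0ℝ} {x} {0ℝ} {n • x} 0≤x (0≤n•x {x} n 0≤x)

x≤x+y : 0ℝ ≤ y → x ≤ x + y
x≤x+y {y} {x} 0≤y = ≤-by-difference 0ℝ y x (x + y) 0≤y
  λ n → solve 2 (λ x y → x :+ y :- x := y :- con 0ℚ) refl (seq x n) (seq y n)

•-monoˡ-≤ : ∀ {m n} → 0ℝ ≤ x → m ℕ.≤ n → m • x ≤ n • x
•-monoˡ-≤ {x} {n = n} 0≤x z≤n       = 0≤n•x {x} n 0≤x
•-monoˡ-≤ {x} {suc m} {suc n} 0≤x (s≤s m≤n) =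
  +-mono-≤ {x} {x} {m • x} {n • x} (≤-refl {x}) (•-monoˡ-≤ {x} 0≤x m≤n)

archimedean : ∀ b → 0ℝ < x → ∃ λ n → b ≤ n • x
archimedean {x} b 0<x = let open ≤-Reasoning in case ∃-upper-bound b of λ where
  (q , b≤q) → case 0<x⇒0<q<x {x} 0<x of λ where
    (c , 0<c , c<x) → case ℚ-archimedean q c 0<c of λ where
      (n , q≤nc) → n , (begin
        b           ≤⟨ b≤q ⟩
        ℚ⇒ℝ q       ≤⟨ pointwise-≤ {ℚ⇒ℝ q} {n • ℚ⇒ℝ c} (λ k →
                         subst (q ℚ.≤_) (sym (seq-• n (ℚ⇒ℝ c) k)) q≤nc) ⟩
        n • ℚ⇒ℝ c   ≤⟨ •-monoʳ-≤ {ℚ⇒ℝ c} {x} n (<⇒≤ {ℚ⇒ℝ c} {x} c<x) ⟩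
        n • x       ∎)

-- Distance to the integers, existence of infima

ℤ⇒ℚ-homo-+ : ∀ i j → ℤ⇒ℚ (i ℤ.+ j) ≡ ℤ⇒ℚ i ℚ.+ ℤ⇒ℚ j
ℤ⇒ℚ-homo-+ i j = ℚ.toℚᵘ-injective (begin-equality
  ℚ.toℚᵘ (ℤ⇒ℚ (i ℤ.+ j))                  ≃⟨ toℚᵘ-ℤ⇒ℚ (i ℤ.+ j) ⟩
  ℚᵘ.mkℚᵘ (i ℤ.+ j) 0                     ≃⟨ ℚᵘ.*≡* (cong (ℤ._* + 1)
    (cong₂ ℤ._+_ (sym (ℤ.*-identityʳ i)) (sym (ℤ.*-identityʳ j)))) ⟩
  ℚᵘ.mkℚᵘ i 0 ℚᵘ.+ ℚᵘ.mkℚᵘ j 0            ≃⟨ ℚᵘ.+-cong (toℚᵘ-ℤ⇒ℚ i) (toℚᵘ-ℤ⇒ℚ j) ⟨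
  ℚ.toℚᵘ (ℤ⇒ℚ i) ℚᵘ.+ ℚ.toℚᵘ (ℤ⇒ℚ j)      ≃⟨ ℚ.toℚᵘ-homo-+ (ℤ⇒ℚ i) (ℤ⇒ℚ j) ⟨
  ℚ.toℚᵘ (ℤ⇒ℚ i ℚ.+ ℤ⇒ℚ j)                ∎)
  where open ℚᵘ.≤-Reasoning

ℤ⇒ℚ-homo-neg : ∀ i → ℤ⇒ℚ (ℤ.- i) ≡ ℚ.- ℤ⇒ℚ i
ℤ⇒ℚ-homo-neg i = trans (sym (p+q-q (ℤ⇒ℚ (ℤ.- i)) (ℤ⇒ℚ i)))
  (trans (cong (ℚ._- ℤ⇒ℚ i) (trans (sym (ℤ⇒ℚ-homo-+ (ℤ.- i) i)) (cong ℤ⇒ℚ (ℤ.+-inverseˡ i))))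
    (ℚ.+-identityˡ _))

‖p+q‖≤‖p‖+‖q‖ : ∀ p q → ‖ p ℚ.+ q ‖ℚ ℚ.≤ ‖ p ‖ℚ ℚ.+ ‖ q ‖ℚ
‖p+q‖≤‖p‖+‖q‖ p q = ℚ.≤-trans (‖‖ℚ-minimal (p ℚ.+ q) (nearest p ℤ.+ nearest q))
  (subst (λ t → ℚ.∣ t ∣ ℚ.≤ ‖ p ‖ℚ ℚ.+ ‖ q ‖ℚ)
    (sym (trans (cong (λ t → p ℚ.+ q ℚ.- t) (ℤ⇒ℚ-homo-+ (nearest p) (nearest q)))
      (+-interchange-- p q (ℤ⇒ℚ (nearest p)) (ℤ⇒ℚ (nearest q)))))
    (ℚ.∣p+q∣≤∣p∣+∣q∣ (p ℚ.- ℤ⇒ℚ (nearest p)) (q ℚ.- ℤ⇒ℚ (nearest q))))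

‖-p‖≤‖p‖ : ∀ p → ‖ ℚ.- p ‖ℚ ℚ.≤ ‖ p ‖ℚ
‖-p‖≤‖p‖ p = ℚ.≤-trans (‖‖ℚ-minimal (ℚ.- p) (ℤ.- nearest p))
  (ℚ.≤-reflexive (trans
    (cong ℚ.∣_∣ (trans (cong (λ t → ℚ.- p ℚ.- t) (ℤ⇒ℚ-homo-neg (nearest p)))
        (neg-- p (ℤ⇒ℚ (nearest p)))))
    (∣-∣ℚ-sym (ℤ⇒ℚ (nearest p)) p)))

‖p‖≤∣p∣ : ∀ p → ‖ p ‖ℚ ℚ.≤ ℚ.∣ p ∣
‖p‖≤∣p∣ p = subst (λ t → ‖ p ‖ℚ ℚ.≤ ℚ.∣ t ∣) (ℚ.+-identityʳ p) (‖‖ℚ-minimal p (+ 0))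

‖k‖≤0 : ∀ k → ‖ ℤ⇒ℚ k ‖ℚ ℚ.≤ 0ℚ
‖k‖≤0 k = subst (λ t → ‖ ℤ⇒ℚ k ‖ℚ ℚ.≤ ℚ.∣ t ∣) (ℚ.+-inverseʳ (ℤ⇒ℚ k)) (‖‖ℚ-minimal (ℤ⇒ℚ k) k)

i<j⇒i+1≤j : ∀ {i j} → i ℤ.< j → ℤ⇒ℚ i ℚ.+ 1ℚ ℚ.≤ ℤ⇒ℚ j
i<j⇒i+1≤j {i} {j} i<j = subst (ℚ._≤ ℤ⇒ℚ j) (ℤ⇒ℚ-suc i) (ℤ⇒ℚ-mono-≤ (ℤ.i<j⇒suc[i]≤j i<j))

-- The two distances add up to at least j - i. Hence at most one integer lies closer than ½, which
-- pins down the nearest integer and keeps different integers different in ℝ.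
i<j⇒1≤∣p-i∣+∣p-j∣ : ∀ {i j} p → i ℤ.< j → 1ℚ ℚ.≤ ∣ p - ℤ⇒ℚ i ∣ℚ ℚ.+ ∣ p - ℤ⇒ℚ j ∣ℚ
i<j⇒1≤∣p-i∣+∣p-j∣ {i} {j} p i<j = ℚ-≤-by-difference
  (ℚ.+-mono-≤ (i<j⇒i+1≤j i<j) (ℚ.+-mono-≤ (p≤∣p∣ (p ℚ.- ℤ⇒ℚ i))
    (subst (ℤ⇒ℚ j ℚ.- p ℚ.≤_) (∣-∣ℚ-sym (ℤ⇒ℚ j) p) (p≤∣p∣ (ℤ⇒ℚ j ℚ.- p)))))
  (solve 5 (λ i j p u v → u :+ v :- con 1ℚ := j :+ (u :+ v) :-
      (i :+ con 1ℚ :+ (p :- i :+ (j :- p))))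
    refl (ℤ⇒ℚ i) (ℤ⇒ℚ j) p ∣ p - ℤ⇒ℚ i ∣ℚ ∣ p - ℤ⇒ℚ j ∣ℚ)

i≢j⇒1≤∣p-i∣+∣p-j∣ : ∀ {i j} p → i ≢ j → 1ℚ ℚ.≤ ∣ p - ℤ⇒ℚ i ∣ℚ ℚ.+ ∣ p - ℤ⇒ℚ j ∣ℚ
i≢j⇒1≤∣p-i∣+∣p-j∣ {i} {j} p i≢j = case ℤ.<-cmp i j of λ where
  (tri< i<j _ _) → i<j⇒1≤∣p-i∣+∣p-j∣ p i<j
  (tri≈ _ i≡j _) → ⊥-elim (i≢j i≡j)
  (tri> _ _ j<i) → subst (1ℚ ℚ.≤_) (ℚ.+-comm ∣ p - ℤ⇒ℚ j ∣ℚ ∣ p - ℤ⇒ℚ i ∣ℚ)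
      (i<j⇒1≤∣p-i∣+∣p-j∣ p j<i)

ℤ⇒ℝ : ℤ → ℝ
ℤ⇒ℝ k = ℚ⇒ℝ (ℤ⇒ℚ k)

∣∣-least : x ≤ y → - x ≤ y → ∣ x ∣ ≤ y
∣∣-least x≤y -x≤y ε ε>0 = Eventually-map₂ (λ n → ∣p∣≤) (x≤y ε ε>0) (-x≤y ε ε>0)

x≤∣x∣ : ∀ x → x ≤ ∣ x ∣
x≤∣x∣ x = pointwise-≤ {x} {∣ x ∣} λ n → p≤∣p∣ (seq x n)

-x≤∣x∣ : ∀ x → - x ≤ ∣ x ∣
-x≤∣x∣ x = pointwise-≤ { - x} {∣ x ∣} λ n →
  subst (ℚ.- seq x n ℚ.≤_) (ℚ.∣-p∣≡∣p∣ (seq x n)) (p≤∣p∣ (ℚ.- seq x n))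

0≤∣x∣ : ∀ x → 0ℝ ≤ ∣ x ∣
0≤∣x∣ x = pointwise-≤ {0ℝ} {∣ x ∣} λ n → ℚ.0≤∣p∣ (seq x n)

‖x‖≤∣x∣ : ∀ x → ‖ x ‖ ≤ ∣ x ∣
‖x‖≤∣x∣ x = pointwise-≤ {‖ x ‖} {∣ x ∣} λ n → ‖p‖≤∣p∣ (seq x n)

‖x+y‖≤‖x‖+‖y‖ : ∀ x y → ‖ x + y ‖ ≤ ‖ x ‖ + ‖ y ‖
‖x+y‖≤‖x‖+‖y‖ x y = pointwise-≤ {‖ x + y ‖} {‖ x ‖ + ‖ y ‖} λ n → ‖p+q‖≤‖p‖+‖q‖ (seq x n) (seq y n)

‖-x‖≤‖x‖ : ∀ x → ‖ - x ‖ ≤ ‖ x ‖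
‖-x‖≤‖x‖ x = pointwise-≤ {‖ - x ‖} {‖ x ‖} λ n → ‖-p‖≤‖p‖ (seq x n)

‖ℤ⇒ℝ‖≤0 : ∀ k → ‖ ℤ⇒ℝ k ‖ ≤ 0ℝ
‖ℤ⇒ℝ‖≤0 k = pointwise-≤ {‖ ℤ⇒ℝ k ‖} {0ℝ} λ n → ‖k‖≤0 k

‖‖-cong : x ≈ y → ‖ x ‖ ≈ ‖ y ‖
‖‖-cong {x} {y} x≈y ε ε>0 = Eventually-map
  (λ n → ℚ.≤-<-trans (∣‖p‖-‖q‖∣≤∣p-q∣ (seq x n) (seq y n))) (x≈y ε ε>0)

‖n•x‖≤n•‖x‖ : ∀ n x → ‖ n • x ‖ ≤ n • ‖ x ‖
‖n•x‖≤n•‖x‖ zero    x = ‖ℤ⇒ℝ‖≤0 (+ 0)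
‖n•x‖≤n•‖x‖ (suc n) x = begin
  ‖ x + n • x ‖       ≤⟨ ‖x+y‖≤‖x‖+‖y‖ x (n • x) ⟩
  ‖ x ‖ + ‖ n • x ‖   ≤⟨
      +-mono-≤ {‖ x ‖} {‖ x ‖} {‖ n • x ‖} {n • ‖ x ‖} (≤-refl {‖ x ‖}) (‖n•x‖≤n•‖x‖ n x) ⟩
  ‖ x ‖ + n • ‖ x ‖   ∎
  where open ≤-Reasoning

n•0≤0 : ∀ n → x ≤ 0ℝ → n • x ≤ 0ℝ
n•0≤0         zero    x≤0 = ≤-refl {0ℝ}
n•0≤0 {x} (suc n) x≤0 = +-mono-≤ {x} {0ℝ} {n • x} {0ℝ} x≤0 (n•0≤0 {x} n x≤0)

≈-by-∣-∣≤0 : ∣ x - y ∣ ≤ 0ℝ → x ≈ y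
≈-by-∣-∣≤0 {x} {y} h ε ε>0 = Eventually-map
  (λ n p → ℚ.≤-<-trans p (subst (ℚ._< ε) (sym (ℚ.+-identityˡ _)) (½ε<ε ε>0)))
      (h (½ ℚ.* ε) (½ε>0 ε>0))

≈⇒∣-∣≤0 : x ≈ y → ∣ x - y ∣ ≤ 0ℝ
≈⇒∣-∣≤0 {x} {y} x≈y ε ε>0 = Eventually-map
  (λ n p → subst (_ ℚ.≤_) (sym (ℚ.+-identityˡ ε)) (ℚ.<⇒≤ p)) (x≈y ε ε>0)

i≢j⇒1≤∣x-i∣+∣x-j∣ : ∀ {i j} x → i ≢ j → ℚ⇒ℝ 1ℚ ≤ ∣ x - ℤ⇒ℝ i ∣ + ∣ x - ℤ⇒ℝ j ∣
i≢j⇒1≤∣x-i∣+∣x-j∣ {i} {j} x i≢j = pointwise-≤ {ℚ⇒ℝ 1ℚ} {∣ x - ℤ⇒ℝ i ∣ + ∣ x - ℤ⇒ℝ j ∣}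
  λ n → i≢j⇒1≤∣p-i∣+∣p-j∣ (seq x n) i≢j

0<1+n : ∀ n → 0ℚ ℚ.< ℤ⇒ℚ (+ suc n)
0<1+n n = ℚ.<-≤-trans (ℚ.positive⁻¹ 1ℚ) (ℤ⇒ℚ-mono-≤ {+ 1} {+ suc n} (ℤ.+≤+ (s≤s z≤n)))

∃-reciprocal : ∀ n → ∃ λ e → 0ℚ ℚ.< e × e ℚ.* ℤ⇒ℚ (+ suc n) ≡ 1ℚ
∃-reciprocal n = ℚ.1/ N , ℚ.positive⁻¹ (ℚ.1/ N) {{ℚ.1/pos⇒pos N}} , ℚ.*-inverseˡ N
  where
  N = ℤ⇒ℚ (+ suc n)
  instance
    _ = ℚ.positive (0<1+n n)
    _ = ℚ.pos⇒nonZero N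

null-sequence : ∃ λ (e : ℕ → ℚ) → (∀ n → 0ℚ ℚ.< e n) × (∀ ε → 0ℚ ℚ.< ε → Eventually λ n → e n ℚ.≤ ε)
null-sequence = (λ n → proj₁ (∃-reciprocal n)) , (λ n → proj₁ (proj₂ (∃-reciprocal n))) , λ ε ε>0 →
  case ℚ-archimedean 1ℚ ε ε>0 of λ where
    (N , 1≤Nε) → N , λ n N≤n → reciprocal≤ ε>0 (ℚ.≤-trans 1≤Nε
      (ℚ.*-monoʳ-≤-nonNeg ε {{ℚ.pos⇒nonNeg ε {{ℚ.positive ε>0}}}}
        (ℤ⇒ℚ-mono-≤ (ℤ.+≤+ (ℕ.m≤n⇒m≤1+n N≤n)))))
        (proj₁ (proj₂ (∃-reciprocal n))) (proj₂ (proj₂ (∃-reciprocal n)))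
  where
  reciprocal≤ : ∀ {e n ε} → 0ℚ ℚ.< ε → 1ℚ ℚ.≤ n ℚ.* ε → 0ℚ ℚ.< e → e ℚ.* n ≡ 1ℚ → e ℚ.≤ ε
  reciprocal≤ {e} {n} {ε} ε>0 1≤nε e>0 en≡1 = begin
    e                  ≡⟨ ℚ.*-identityʳ e ⟨
    e ℚ.* 1ℚ           ≤⟨ ℚ.*-monoˡ-≤-nonNeg e {{ℚ.pos⇒nonNeg e {{ℚ.positive e>0}}}} 1≤nε ⟩
    e ℚ.* (n ℚ.* ε)    ≡⟨ ℚ.*-assoc e n ε ⟨
    e ℚ.* n ℚ.* ε      ≡⟨ cong (ℚ._* ε) en≡1 ⟩
    1ℚ ℚ.* ε           ≡⟨ ℚ.*-identityˡ ε ⟩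
    ε                  ∎
    where open ℚ.≤-Reasoning

module _ (em : ExcludedMiddle 0ℓ) where

  ≰⇒> : ¬ x ≤ y → y < x
  ≰⇒> {x} {y} x≰y = case em {P = y < x} of λ where
    (yes y<x) → y<x
    (no  y≮x) → ⊥-elim (x≰y (≮⇒≥ {y} {x} y≮x))

  ¬∀⇒∃¬ : {A : Set} {P : A → Set} → ¬ (∀ a → P a) → ∃ λ a → ¬ P a
  ¬∀⇒∃¬ {A} {P} ¬∀ = case em {P = ∃ λ a → ¬ P a} of λ where
    (yes p) → p
    (no ¬p) → ⊥-elim (¬∀ λ a → case em {P = P a} of λ where
      (yes q) → q
      (no ¬q) → ⊥-elim (¬p (a , ¬q)))

  -- Some integer k lies closer than ½, as otherwise ½ would be a lower bound exceeding the infimum.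
  -- An integer closer than k would make two distances with sum below 1. The integer is not read off
  -- from `nearest`, which acts on single terms and may change along the sequence.
  ‖‖-attained : ∀ t → ‖ t ‖ < ℚ⇒ℝ ½ → ∃ λ k → ∣ t - ℤ⇒ℝ k ∣ ≤ ‖ t ‖
  ‖‖-attained t ‖t‖<½ = case em {P = ∀ k → ℚ⇒ℝ ½ ≤ ∣ t - ℤ⇒ℝ k ∣} of λ where
      (yes far) → ⊥-elim (<-≤-⊥ {‖ t ‖} {ℚ⇒ℝ ½} ‖t‖<½ (greatest (ℚ⇒ℝ ½) far))
      (no ¬far) → case ¬∀⇒∃¬ ¬far of λ where
        (k , near) → k , greatest ∣ t - ℤ⇒ℝ k ∣ λ j → case k ℤ.≟ j of λ where
          (yes refl) → ≤-refl {∣ t - ℤ⇒ℝ k ∣}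
          (no  k≢j)  → ≮⇒≥ {∣ t - ℤ⇒ℝ j ∣} {∣ t - ℤ⇒ℝ k ∣} λ j<k → <-irrefl {ℚ⇒ℝ 1ℚ} (begin-strict
            ℚ⇒ℝ 1ℚ                          ≤⟨ i≢j⇒1≤∣x-i∣+∣x-j∣ t k≢j ⟩
            ∣ t - ℤ⇒ℝ k ∣ + ∣ t - ℤ⇒ℝ j ∣
                <⟨ +-mono-<-≤ {∣ t - ℤ⇒ℝ k ∣} {ℚ⇒ℝ ½} {∣ t - ℤ⇒ℝ j ∣} {ℚ⇒ℝ ½}
                (≰⇒> {ℚ⇒ℝ ½} {∣ t - ℤ⇒ℝ k ∣} near)
                (<⇒≤ {∣ t - ℤ⇒ℝ j ∣} {ℚ⇒ℝ ½} (<-trans {∣ t - ℤ⇒ℝ j ∣} {∣ t - ℤ⇒ℝ k ∣} {ℚ⇒ℝ ½} j<k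
                  (≰⇒> {ℚ⇒ℝ ½} {∣ t - ℤ⇒ℝ k ∣} near))) ⟩
            ℚ⇒ℝ ½ + ℚ⇒ℝ ½                   ≈⟨ pointwise-≈ {ℚ⇒ℝ ½ + ℚ⇒ℝ ½} {ℚ⇒ℝ 1ℚ} (λ _ → refl) ⟩
            ℚ⇒ℝ 1ℚ                          ∎)
    where
    open IsInfimum (‖‖-isInfimum t)
    open ≤-Reasoning

  module _ {I : Set} (f : I → ℝ) (i₀ : I) (l : ℚ) (l≤f : ∀ i → ℚ⇒ℝ l ≤ f i) where
    private
      LowerBound : ℚ → Set
      LowerBound q = ∀ i → ℚ⇒ℝ q ≤ f i

    -- Walk up from l in steps of ε. If no step ever failed, every l + nε would be a lower bound,
    -- and one of them exceeds `f i₀` by the Archimedean property.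
    ∃-ε-best-lower-bound : ∀ ε → 0ℚ ℚ.< ε → ∃ λ q → LowerBound q × ¬ LowerBound (q ℚ.+ ε)
    ∃-ε-best-lower-bound ε ε>0 = case em {P = ∃ λ q → LowerBound q × ¬ LowerBound (q ℚ.+ ε)} of
        λ where
        (yes best) → best
        (no ¬best) → ⊥-elim (case ∃-upper-bound (f i₀) of λ where
          (b , f≤b) → case ℚ-archimedean (b ℚ.+ 1ℚ ℚ.- l) ε ε>0 of λ where
            (n , b+1-l≤nε) → ℚ.<-irrefl refl (ℚ⇒ℝ-cancel-< (begin-strict
              ℚ⇒ℝ b                          <⟨ ℚ⇒ℝ-mono-< (ℚ-<-by-difference (ℚ.positive⁻¹ 1ℚ)
                  (solve 1 (λ b → b :+ con 1ℚ :- b := con 1ℚ :- con 0ℚ) refl b)) ⟩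
              ℚ⇒ℝ (b ℚ.+ 1ℚ)
                  ≤⟨ ℚ⇒ℝ-mono-≤ {b ℚ.+ 1ℚ} {l ℚ.+ ℤ⇒ℚ (+ n) ℚ.* ε} (ℚ-≤-by-difference b+1-l≤nε
                  (solve 3 (λ b l nε → l :+ nε :- (b :+ con 1ℚ) := nε :- (b :+ con 1ℚ :- l)) refl b
                      l (ℤ⇒ℚ (+ n) ℚ.* ε))) ⟩
              ℚ⇒ℝ (l ℚ.+ ℤ⇒ℚ (+ n) ℚ.* ε)    ≤⟨ all ¬best n i₀ ⟩
              f i₀                           ≤⟨ f≤b ⟩
              ℚ⇒ℝ b                          ∎)))
      where
      open ≤-Reasoning
      all : ¬ (∃ λ q → LowerBound q × ¬ LowerBound (q ℚ.+ ε)) → ∀ n → LowerBound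
          (l ℚ.+ ℤ⇒ℚ (+ n) ℚ.* ε)
      all ¬best zero    = subst LowerBound
          (sym (trans (cong (l ℚ.+_) (ℚ.*-zeroˡ ε)) (ℚ.+-identityʳ l))) l≤f
      all ¬best (suc n) = case em {P = LowerBound (l ℚ.+ ℤ⇒ℚ (+ suc n) ℚ.* ε)} of λ where
        (yes lb) → lb
        (no ¬lb) → ⊥-elim (¬best (l ℚ.+ ℤ⇒ℚ (+ n) ℚ.* ε , all ¬best n , ¬lb ∘ subst LowerBound
          (trans (solve 3 (λ l n ε → l :+ n :* ε :+ ε := l :+ (n :+ con 1ℚ) :* ε) refl l (ℤ⇒ℚ (+ n))
              ε)
            (cong (λ t → l ℚ.+ t ℚ.* ε) (sym (ℤ⇒ℚ-suc (+ n)))))))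

    LowerBound-downward : ∀ {p q} → p ℚ.≤ q → LowerBound q → LowerBound p
    LowerBound-downward {p} {q} p≤q lb i = ≤-trans {ℚ⇒ℝ p} {ℚ⇒ℝ q} {f i} (ℚ⇒ℝ-mono-≤ p≤q) (lb i)

    infimum : ∃ (IsInfimum f)
    infimum = from-sequence
        (λ n → proj₁ (best n)) (λ n → proj₁ (proj₂ (best n))) (λ n → proj₂ (proj₂ (best n)))
      where
      e   = proj₁ null-sequence
      e→0 = proj₂ (proj₂ null-sequence)
      best : ∀ n → ∃ λ q → LowerBound q × ¬ LowerBound (q ℚ.+ e n)
      best n = ∃-ε-best-lower-bound (e n) (proj₁ (proj₂ null-sequence) n)
      from-sequence : (q : ℕ → ℚ) → (∀ n → LowerBound (q n)) → (∀ n → ¬ LowerBound (q n ℚ.+ e n)) →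
          ∃ (IsInfimum f)
      from-sequence q lb ¬lb = m , record
        { lowerBound = λ i → ≮⇒≥ {f i} {m} λ fi<m → case <-dense {f i} {m} fi<m of λ where
            (r , fi<r , δ , δ>0 , N , r+δ≤q) → ℚ.<-irrefl refl
                (ℚ⇒ℝ-cancel-< (let open ≤-Reasoning in begin-strict
              ℚ⇒ℝ (q N)  ≤⟨ lb N i ⟩
              f i        <⟨ fi<r ⟩
              ℚ⇒ℝ r      ≤⟨ ℚ⇒ℝ-mono-≤ {r} {q N}
                  (ℚ-≤-by-difference (ℚ.+-mono-≤ (r+δ≤q N ℕ.≤-refl) (ℚ.<⇒≤ δ>0))
                  (solve 3 (λ r δ q → q :- r := q :+ δ :- (r :+ δ :+ con 0ℚ)) refl r δ (q N))) ⟩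
              ℚ⇒ℝ (q N)  ∎))
        ; greatest = λ g g≤f → ≮⇒≥ {m} {g} λ m<g → case <-dense {m} {g} m<g of λ where
            (r , (δ , δ>0 , M , q+δ≤r) , r<g) → case e→0 δ δ>0 of λ where
              (N , e≤δ) → ¬lb (M ℕ.⊔ N) (LowerBound-downward
                (ℚ.≤-trans (ℚ.+-monoʳ-≤ (q (M ℕ.⊔ N)) (e≤δ _ (ℕ.m≤n⊔m M N)))
                    (q+δ≤r _ (ℕ.m≤m⊔n M N)))
                λ i → ≤-trans {ℚ⇒ℝ r} {g} {f i} (<⇒≤ {ℚ⇒ℝ r} {g} r<g) (g≤f i))
        }
        where
        -- `q m` is a lower bound and `q n ℚ.+ e n` is not, so the former cannot exceed the latter.
        -- With m and n exchanged this makes q Cauchy.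
        ≤-within : ∀ {δ} m n → e n ℚ.≤ δ → q m ℚ.≤ q n ℚ.+ δ
        ≤-within {δ} m n en≤δ = ℚ.≤-trans
          ([ (λ h → h) , (λ h → ⊥-elim (¬lb n (LowerBound-downward h (lb m)))) ]′
              (ℚ.≤-total (q m) (q n ℚ.+ e n)))
          (ℚ.+-monoʳ-≤ (q n) en≤δ)
        m = mkℝ q λ ε ε>0 → case e→0 (½ ℚ.* ε) (½ε>0 ε>0) of λ where
          (N , h) → N , λ i j N≤i N≤j → ℚ.≤-<-trans
            (p≤q+r,q≤p+r⇒∣p-q∣≤r (≤-within i j (h j N≤j)) (≤-within j i (h i N≤i))) (½ε<ε ε>0)

-- Cardinalities

module _ (em : ExcludedMiddle 0ℓ) {A B : Setoid 0ℓ 0ℓ} (f : Injection A B) (g : Injection B A) where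
  private
    module A = Setoid A
    module B = Setoid B
    module f = Injection f
    module g = Injection g

    -- The points reached by iterating g ∘ f from outside the image of g, up to ≈. The bijection is
    -- f on them and inverts g elsewhere, where every point lies in the image of g.
    data Chain : A.Carrier → Set where
      start : ∀ {a} → (∀ b → ¬ g.to b A.≈ a) → Chain a
      step  : ∀ {a a′} → Chain a → a′ A.≈ g.to (f.to a) → Chain a′

    Chain-resp-≈ : ∀ {a a′} → a A.≈ a′ → Chain a → Chain a′
    Chain-resp-≈ a≈a′ (start ∉g) = start λ b gb≈a′ → ∉g b (A.trans gb≈a′ (A.sym a≈a′))
    Chain-resp-≈ a≈a′ (step c a≈gfa₀) = step c (A.trans (A.sym a≈a′) a≈gfa₀)

    -- The graph of the bijection. Functionality and injectivity up to ≈ are proved for the graph,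
    -- where it does not matter which witnesses `image` happens to pick.
    Image : A.Carrier → B.Carrier → Set
    Image a b = (Chain a × b B.≈ f.to a) ⊎ (¬ Chain a × g.to b A.≈ a)

    image : ∀ a → ∃ (Image a)
    image a = case em {P = Chain a} of λ where
      (yes c) → f.to a , inj₁ (c , B.refl)
      (no ¬c) → case em {P = ∃ λ b → g.to b A.≈ a} of λ where
        (yes (b , gb≈a)) → b , inj₂ (¬c , gb≈a)
        (no ∉g) → ⊥-elim (¬c (start λ b gb≈a → ∉g (b , gb≈a)))

    Image-functional : ∀ {a a′ b b′} → a A.≈ a′ → Image a b → Image a′ b′ → b B.≈ b′
    Image-functional a≈a′ (inj₁ (_ , b≈fa)) (inj₁ (_ , b′≈fa′)) =
      B.trans b≈fa (B.trans (f.cong a≈a′) (B.sym b′≈fa′))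
    Image-functional a≈a′ (inj₂ (_ , gb≈a)) (inj₂ (_ , gb′≈a′)) =
      g.injective (A.trans gb≈a (A.trans a≈a′ (A.sym gb′≈a′)))
    Image-functional a≈a′ (inj₁ (c , _)) (inj₂ (¬c , _)) = ⊥-elim (¬c (Chain-resp-≈ a≈a′ c))
    Image-functional a≈a′ (inj₂ (¬c , _)) (inj₁ (c , _)) = ⊥-elim (¬c (Chain-resp-≈ (A.sym a≈a′) c))

    -- If g sent b to a point a′ off the chains, a′ ≈ g (f a) would prolong the chain of a to a′.
    Image-mixed : ∀ {a a′ b b′} → b B.≈ b′ → Chain a → b B.≈ f.to a → ¬ Chain a′ → ¬ g.to b′ A.≈ a′
    Image-mixed b≈b′ c b≈fa ¬c gb′≈a′ =
      ¬c (step c (A.trans (A.sym gb′≈a′) (g.cong (B.trans (B.sym b≈b′) b≈fa))))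

    Image-injective : ∀ {a a′ b b′} → b B.≈ b′ → Image a b → Image a′ b′ → a A.≈ a′
    Image-injective b≈b′ (inj₁ (_ , b≈fa)) (inj₁ (_ , b′≈fa′)) =
      f.injective (B.trans (B.sym b≈fa) (B.trans b≈b′ b′≈fa′))
    Image-injective b≈b′ (inj₂ (_ , gb≈a)) (inj₂ (_ , gb′≈a′)) =
      A.trans (A.sym gb≈a) (A.trans (g.cong b≈b′) gb′≈a′)
    Image-injective b≈b′ (inj₁ (c , p)) (inj₂ (¬c , q)) = ⊥-elim (Image-mixed b≈b′ c p ¬c q)
    Image-injective b≈b′ (inj₂ (¬c , q)) (inj₁ (c , p)) = ⊥-elim (Image-mixed (B.sym b≈b′) c p ¬c q)

    Image-surjective : ∀ b → ∃ λ a → Image a b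
    Image-surjective b = case em {P = Chain (g.to b)} of λ where
      (yes (start ∉g)) → ⊥-elim (∉g b A.refl)
      (yes (step {a} c gb≈gfa)) → a , inj₁ (c , g.injective gb≈gfa)
      (no ¬c) → g.to b , inj₂ (¬c , A.refl)

  schröder-bernstein : Bijection A B
  schröder-bernstein = record
    { to        = λ a → proj₁ (image a)
    ; cong      = λ {a} {a′} a≈a′ → Image-functional a≈a′ (proj₂ (image a)) (proj₂ (image a′))
    ; bijective = (λ {a} {a′} b≈b′ → Image-injective b≈b′ (proj₂ (image a)) (proj₂ (image a′)))
                , λ b → let a , a↦b = Image-surjective b in
                    a , λ {a′} a′≈a → Image-functional a′≈a (proj₂ (image a′)) a↦b
    }

-- The number 2^a (2b + 1). Parity gives injectivity, and an injection into ℕ is all that the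
-- cardinality arguments need.
pair : ℕ → ℕ → ℕ
pair zero    b = suc (2 ℕ.* b)
pair (suc a) b = 2 ℕ.* pair a b

pair-injective : ∀ a b c d → pair a b ≡ pair c d → a ≡ c × b ≡ d
pair-injective zero    b zero    d eq = refl , ℕ.*-cancelˡ-≡ b d 2 (ℕ.suc-injective eq)
pair-injective zero    b (suc c) d eq = ⊥-elim (ℕ.even≢odd (pair c d) b (sym eq))
pair-injective (suc a) b zero    d eq = ⊥-elim (ℕ.even≢odd (pair a b) d eq)
pair-injective (suc a) b (suc c) d eq =
  let a≡c , b≡d = pair-injective a b c d (ℕ.*-cancelˡ-≡ (pair a b) (pair c d) 2 eq) in cong suc a≡c , b≡d

ℤ⇒ℕ : ℤ → ℕ
ℤ⇒ℕ (+ n)    = pair 0 n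
ℤ⇒ℕ -[1+ n ] = pair 1 n

ℤ⇒ℕ-injective : ∀ i j → ℤ⇒ℕ i ≡ ℤ⇒ℕ j → i ≡ j
ℤ⇒ℕ-injective (+ m)    (+ n)    eq = cong +_ (proj₂ (pair-injective 0 m 0 n eq))
ℤ⇒ℕ-injective -[1+ m ] -[1+ n ] eq = cong -[1+_] (proj₂ (pair-injective 1 m 1 n eq))
ℤ⇒ℕ-injective (+ m)    -[1+ n ] eq = case proj₁ (pair-injective 0 m 1 n eq) of λ ()
ℤ⇒ℕ-injective -[1+ m ] (+ n)    eq = case proj₁ (pair-injective 1 m 0 n eq) of λ ()

ℚ⇒ℕ : ℚ → ℕ
ℚ⇒ℕ (mkℚ i d-1 _) = pair (ℤ⇒ℕ i) d-1

ℚ⇒ℕ-injective : ∀ p q → ℚ⇒ℕ p ≡ ℚ⇒ℕ q → p ≡ q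
ℚ⇒ℕ-injective (mkℚ i d-1 _) (mkℚ j e-1 _) eq =
  let i≡j , d≡e = pair-injective (ℤ⇒ℕ i) d-1 (ℤ⇒ℕ j) e-1 eq in
  ℚ.mkℚ-cong (ℤ⇒ℕ-injective i j i≡j) d≡e

-- Badly approximable numbers

partialSum-mono : ∀ {ψ m n} → (∀ n → 1 ℕ.≤ n → 0ℝ ≤ ψ n) → m ℕ.≤ n → partialSum ψ m ≤ partialSum ψ n
partialSum-mono {ψ} {m} {n} ψ≥0 m≤n = case ℕ.m≤n⇒∃[o]m+o≡n m≤n of λ where
    (k , refl) → subst (λ n → partialSum ψ m ≤ partialSum ψ n) (ℕ.+-comm k m) (go k)
  where
  go : ∀ k → partialSum ψ m ≤ partialSum ψ (k ℕ.+ m)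
  go zero    = ≤-refl {partialSum ψ m}
  go (suc k) = ≤-trans {partialSum ψ m} {partialSum ψ (k ℕ.+ m)} {partialSum ψ (suc k ℕ.+ m)} (go k)
    (x≤x+y {ψ (suc k ℕ.+ m)} {partialSum ψ (k ℕ.+ m)} (ψ≥0 (suc k ℕ.+ m) (s≤s z≤n)))

x<x+1 : ∀ x → x < x + ℚ⇒ℝ 1ℚ
x<x+1 x = 1ℚ , ℚ.positive⁻¹ 1ℚ , 0 , λ _ _ → ℚ.≤-refl

unbounded⇒divergent : ∀ {ψ} → (∀ n → 1 ℕ.≤ n → 0ℝ ≤ ψ n) → (∀ B → ∃ λ N → B ≤ partialSum ψ N) →
                      ∀ B → Eventually λ N → B < partialSum ψ N
unbounded⇒divergent {ψ} ψ≥0 unbounded B = case unbounded (B + ℚ⇒ℝ 1ℚ) of λ where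
  (N , B+1≤) → N , λ n N≤n → let open ≤-Reasoning in begin-strict
    B                <⟨ x<x+1 B ⟩
    B + ℚ⇒ℝ 1ℚ       ≤⟨ B+1≤ ⟩
    partialSum ψ N   ≤⟨ partialSum-mono {ψ} ψ≥0 N≤n ⟩
    partialSum ψ n   ∎

partialSum-growth : ∀ ψ δ a t → (∀ i → i ℕ.< t → δ ≤ ψ (suc (i ℕ.+ a))) →
                    t • δ + partialSum ψ a ≤ partialSum ψ (t ℕ.+ a)
partialSum-growth ψ δ a zero    _  = ≈⇒≤ {0ℝ + partialSum ψ a} {partialSum ψ a}
  (pointwise-≈ {0ℝ + partialSum ψ a} {partialSum ψ a} λ n → ℚ.+-identityˡ _)
partialSum-growth ψ δ a (suc t) δ≤ = begin
  δ + t • δ + partialSum ψ a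
      ≈⟨ pointwise-≈ {δ + t • δ + partialSum ψ a} {t • δ + partialSum ψ a + δ} (λ n →
      solve 3 (λ δ tδ s → δ :+ tδ :+ s := tδ :+ s :+ δ) refl (seq δ n) (seq (t • δ) n)
          (seq (partialSum ψ a) n)) ⟩
  t • δ + partialSum ψ a + δ
      ≤⟨ +-mono-≤ {t • δ + partialSum ψ a} {partialSum ψ (t ℕ.+ a)} {δ} {ψ (suc (t ℕ.+ a))}
      (partialSum-growth ψ δ a t λ i i<t → δ≤ i (ℕ.m<n⇒m<1+n i<t)) (δ≤ t ℕ.≤-refl) ⟩
  partialSum ψ (t ℕ.+ a) + ψ (suc (t ℕ.+ a))     ∎
  where open ≤-Reasoning

antitone : ∀ {f : ℕ → ℝ} → (∀ n → f (suc n) ≤ f n) → ∀ {m n} → m ℕ.≤ n → f n ≤ f m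
antitone {f} step {m} m≤n = case ℕ.m≤n⇒∃[o]m+o≡n m≤n of λ where
    (k , refl) → subst (λ n → f n ≤ f m) (ℕ.+-comm k m) (go k)
  where
  go : ∀ k → f (k ℕ.+ m) ≤ f m
  go zero    = ≤-refl {f m}
  go (suc k) = ≤-trans {f (suc k ℕ.+ m)} {f (k ℕ.+ m)} {f m} (step (k ℕ.+ m)) (go k)

-- y cancels in the difference of the two points. This turns a lower bound for `‖ d • x ‖` into a
-- separation of the indices at which `‖ n • x + y ‖` is small.
‖d•x‖≤‖[d+a]•x+y‖+‖a•x+y‖ : ∀ x y a d → ‖ d • x ‖ ≤ ‖ (d ℕ.+ a) • x + y ‖ + ‖ a • x + y ‖
‖d•x‖≤‖[d+a]•x+y‖+‖a•x+y‖ x y a d = begin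
  ‖ d • x ‖
    ≈⟨ ‖‖-cong {d • x} {((d ℕ.+ a) • x + y) + - (a • x + y)}
         (≈-trans {d • x} {((d • x + a • x) + y) + - (a • x + y)}
             {((d ℕ.+ a) • x + y) + - (a • x + y)}
           (pointwise-≈ {d • x} {((d • x + a • x) + y) + - (a • x + y)} λ n →
             solve 3 (λ d a y → d := ((d :+ a) :+ y) :+ (:- (a :+ y))) refl (seq (d • x) n)
                 (seq (a • x) n) (seq y n))
           (+-cong {(d • x + a • x) + y} {(d ℕ.+ a) • x + y} { - (a • x + y)} { - (a • x + y)}
             (+-cong {d • x + a • x} {(d ℕ.+ a) • x} {y} {y}
               (≈-sym {(d ℕ.+ a) • x} {d • x + a • x} (•-homo-+ x d a)) (≈-refl {y}))
                   (≈-refl { - (a • x + y)}))) ⟩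
  ‖ ((d ℕ.+ a) • x + y) + - (a • x + y) ‖
    ≤⟨ ‖x+y‖≤‖x‖+‖y‖ ((d ℕ.+ a) • x + y) (- (a • x + y)) ⟩
  ‖ (d ℕ.+ a) • x + y ‖ + ‖ - (a • x + y) ‖
    ≤⟨ +-mono-≤ {‖ (d ℕ.+ a) • x + y ‖} {‖ (d ℕ.+ a) • x + y ‖} {‖ - (a • x + y) ‖} {‖ a • x + y ‖}
         (≤-refl {‖ (d ℕ.+ a) • x + y ‖}) (‖-x‖≤‖x‖ (a • x + y)) ⟩
  ‖ (d ℕ.+ a) • x + y ‖ + ‖ a • x + y ‖
    ∎
  where open ≤-Reasoning

-- Halving by contradiction: d δ < κ would give d (γ + δ) ≤ 2 d δ < 2 κ. In use δ is a minimum of D,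
-- γ the next one and d the distance of their indices.
κ≤d•δ : ∀ d γ δ κ → κ + κ ≤ d • (γ + δ) → γ ≤ δ → κ ≤ d • δ
κ≤d•δ d γ δ κ 2κ≤ γ≤δ = ≮⇒≥ {d • δ} {κ} λ dδ<κ → <-irrefl {κ + κ} (begin-strict
  κ + κ           ≤⟨ 2κ≤ ⟩
  d • (γ + δ)     ≤⟨ •-monoʳ-≤ {γ + δ} {δ + δ} d (+-mono-≤ {γ} {δ} {δ} {δ} γ≤δ (≤-refl {δ})) ⟩
  d • (δ + δ)     ≈⟨ •-distrib-+ δ δ d ⟩
  d • δ + d • δ   <⟨ +-mono-<-≤ {d • δ} {κ} {d • δ} {κ} dδ<κ (<⇒≤ {d • δ} {κ} dδ<κ) ⟩
  κ + κ           ∎)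
  where open ≤-Reasoning

-- Sequences whose small values are far apart

module RunningMinimum (em : ExcludedMiddle 0ℓ) (E : ℕ → ℝ) where

  -- Keeping track of the argument chosen, as a propositional equality, later identifies each fall
  -- of the running minimum with a value of E.
  minimum : ∀ x y → ∃ λ m → m ≤ x × m ≤ y × (m ≡ x ⊎ m ≡ y)
  minimum x y = case em {P = x ≤ y} of λ where
    (yes x≤y) → x , ≤-refl {x} , x≤y , inj₁ refl
    (no  x≰y) → y , <⇒≤ {y} {x} (≰⇒> em {x} {y} x≰y) , ≤-refl {y} , inj₂ refl

  runmin : ℕ → ℝ
  runmin zero    = E 0
  runmin (suc n) = proj₁ (minimum (runmin n) (E (suc n)))

  runmin-step : ∀ n → runmin (suc n) ≤ runmin n
  runmin-step n = proj₁ (proj₂ (minimum (runmin n) (E (suc n))))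

  runmin≤ : ∀ n → runmin n ≤ E n
  runmin≤ zero    = ≤-refl {E 0}
  runmin≤ (suc n) = proj₁ (proj₂ (proj₂ (minimum (runmin n) (E (suc n)))))

  runmin-attained : ∀ n → runmin (suc n) ≡ runmin n ⊎ runmin (suc n) ≡ E (suc n)
  runmin-attained n = proj₂ (proj₂ (proj₂ (minimum (runmin n) (E (suc n)))))

  runmin-elim : (P : ℝ → Set) (N : ℕ) → (∀ n → n ℕ.≤ N → P (E n)) → ∀ n → n ℕ.≤ N → P (runmin n)
  runmin-elim P N p zero    0≤N = p 0 0≤N
  runmin-elim P N p (suc n) n<N = [ (λ eq → subst P (sym eq) (runmin-elim P N p n (ℕ.<⇒≤ n<N)))
                                  , (λ eq → subst P (sym eq) (p (suc n) n<N)) ]′ (runmin-attained n)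

module Separated (em : ExcludedMiddle 0ℓ) (D : ℕ → ℝ) (κ : ℝ) (0<κ : 0ℝ < κ)
  (2κ≤ : ∀ a d → 1 ℕ.≤ d → κ + κ ≤ d • (D (d ℕ.+ a) + D a)) where

  -- At most one value of D is non-positive: a second one, d places after a, would give 2κ ≤
  -- `d • (D (d ℕ.+ a) + D a)` ≤ 0.
  eventually-positive : ∃ λ M → ∀ n → M ℕ.< n → 0ℝ < D n
  eventually-positive = case em {P = ∃ λ a → D a ≤ 0ℝ} of λ where
      (no none)        → 0 , λ n _ → ≰⇒> em {D n} {0ℝ} λ Dn≤0 → none (n , Dn≤0)
      (yes (a , Da≤0)) → a , λ n a<n → ≰⇒> em {D n} {0ℝ} λ Dn≤0 →
        <-≤-⊥ {0ℝ} {κ + κ} 0<2κ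
          (≤-trans {κ + κ} {(n ℕ.∸ a) • (D (n ℕ.∸ a ℕ.+ a) + D a)} {0ℝ}
              (2κ≤ a (n ℕ.∸ a) (ℕ.m<n⇒0<n∸m a<n))
            (n•0≤0 {D (n ℕ.∸ a ℕ.+ a) + D a} (n ℕ.∸ a) (+-mono-≤ {D (n ℕ.∸ a ℕ.+ a)} {0ℝ} {D a} {0ℝ}
              (subst (λ n → D n ≤ 0ℝ) (sym (ℕ.m∸n+n≡m (ℕ.<⇒≤ a<n))) Dn≤0) Da≤0)))
    where
    0<2κ : 0ℝ < κ + κ
    0<2κ = +-mono-<-≤ {0ℝ} {κ} {0ℝ} {κ} 0<κ (<⇒≤ {0ℝ} {κ} 0<κ)

  module _ (M : ℕ) (0<D : ∀ n → M ℕ.< n → 0ℝ < D n) where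

    -- Taking n ⊔ (M + 1) for n hides the values up to M, which may include a zero, and still gives
    -- a sequence on all of ℕ.
    open RunningMinimum em (λ n → D (n ℕ.⊔ suc M))

    0<runmin : ∀ n → 0ℝ < runmin n
    0<runmin n = runmin-elim (0ℝ <_) n (λ n _ → 0<D (n ℕ.⊔ suc M) (ℕ.m≤n⊔m n (suc M))) n ℕ.≤-refl

    0≤runmin : ∀ n → 1 ℕ.≤ n → 0ℝ ≤ runmin n
    0≤runmin n _ = <⇒≤ {0ℝ} {runmin n} (0<runmin n)

    runmin≤D : ∀ n → M ℕ.< n → runmin n ≤ D n
    runmin≤D n M<n = subst (λ k → runmin n ≤ D k) (ℕ.m≥n⇒m⊔n≡m M<n) (runmin≤ n)

    -- The minimum up to `suc a` is attained at `suc a` itself. The shift matches `partialSum`,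
    -- whose value at a stops just before that term.
    Record : ℕ → Set
    Record a = M ℕ.≤ a × D (suc a) ≤ runmin (suc a)

    first-record : Record M
    first-record = ℕ.≤-refl , runmin-elim (D (suc M) ≤_) (suc M)
      (λ n n≤1+M → subst (λ k → D (suc M) ≤ D k) (sym (ℕ.m≤n⇒m⊔n≡n n≤1+M)) (≤-refl {D (suc M)}))
          (suc M) ℕ.≤-refl

    NextRecord : ℕ → Set
    NextRecord a = ∃ λ b → Record b × κ + partialSum runmin a ≤ partialSum runmin b

    private module _ (a : ℕ) (M≤a : M ℕ.≤ a) (record-a : D (suc a) ≤ runmin (suc a)) where
      -- With δ = `D (suc a)`, the running minimum is at least δ at the `suc t` indices from `suc a`
      -- to `suc (t ℕ.+ a)` and then falls. It falls to a value of D less than δ, so `κ≤d•δ` with d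
      -- = `suc t` makes these terms contribute at least κ.
      next-at : ∀ t → D (suc a) ≤ runmin (suc (t ℕ.+ a)) → ¬ D (suc a) ≤ runmin (suc (suc t ℕ.+ a))
          → NextRecord a
      next-at t δ≤ ¬δ≤ = b′ ,
          (M≤b′ , ≈⇒≤ {D (suc b′)} {runmin (suc b′)}
          (subst (_≈ runmin (suc b′)) runmin≡D (≈-refl {runmin (suc b′)}))) , (begin
        κ + partialSum runmin a
            ≤⟨ +-mono-≤ {κ} {suc t • D (suc a)} {partialSum runmin a} {partialSum runmin a} κ≤
            (≤-refl {partialSum runmin a}) ⟩
        suc t • D (suc a) + partialSum runmin a
            ≤⟨ partialSum-growth runmin (D (suc a)) a (suc t) (λ i i<1+t →
            ≤-trans {D (suc a)} {runmin (suc (t ℕ.+ a))} {runmin (suc (i ℕ.+ a))} δ≤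
              (antitone {runmin} runmin-step (s≤s (ℕ.+-monoˡ-≤ a (ℕ.≤-pred i<1+t))))) ⟩
        partialSum runmin b′                    ∎)
        where
        open ≤-Reasoning
        b′ : ℕ
        b′ = suc t ℕ.+ a
        M≤b′ : M ℕ.≤ b′
        M≤b′ = ℕ.≤-trans M≤a (ℕ.m≤n+m a (suc t))
        runmin<δ : runmin (suc b′) < D (suc a)
        runmin<δ = ≰⇒> em {D (suc a)} {runmin (suc b′)} ¬δ≤
        runmin≡D : runmin (suc b′) ≡ D (suc b′)
        runmin≡D = [ (λ eq → ⊥-elim (¬δ≤ (subst (D (suc a) ≤_) (sym eq) δ≤)))
                   , (λ eq → trans eq (cong D (ℕ.m≥n⇒m⊔n≡m (s≤s M≤b′)))) ]′ (runmin-attained b′)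
        D<δ : D (suc t ℕ.+ suc a) < D (suc a)
        D<δ = subst (_< D (suc a)) (trans runmin≡D (cong D (sym (ℕ.+-suc (suc t) a)))) runmin<δ
        κ≤ : κ ≤ suc t • D (suc a)
        κ≤ = κ≤d•δ (suc t) (D (suc t ℕ.+ suc a)) (D (suc a)) κ (2κ≤ (suc a) (suc t) (s≤s z≤n))
            (<⇒≤ {D (suc t ℕ.+ suc a)} {D (suc a)} D<δ)

      next-or-above : ∀ t → D (suc a) ≤ runmin (suc (t ℕ.+ a)) ⊎ NextRecord a
      next-or-above zero    = inj₁ record-a
      next-or-above (suc t) = case next-or-above t of λ where
        (inj₂ next) → inj₂ next
        (inj₁ δ≤)   → case em {P = D (suc a) ≤ runmin (suc (suc t ℕ.+ a))} of λ where
          (yes δ≤′) → inj₁ δ≤′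
          (no ¬δ≤′) → inj₂ (next-at t δ≤ ¬δ≤′)

    module _ (B : ℝ) (S<B : ∀ N → partialSum runmin N < B) where

      -- Without a further record all terms from `suc a` on are at least `D (suc a)` > 0, and enough
      -- of them exceed the bound B.
      next-record : ∀ a → Record a → NextRecord a
      next-record a (M≤a , record-a) = case em {P = NextRecord a} of λ where
          (yes next) → next
          (no ¬next) → ⊥-elim (case archimedean {D (suc a)} B (0<D (suc a) (s≤s M≤a)) of λ where
            (t , B≤tδ) → <-irrefl {B} (begin-strict
              B                        ≤⟨ B≤tδ ⟩
              t • D (suc a)
                  ≤⟨ x≤x+y {partialSum runmin a} {t • D (suc a)}
                  (partialSum-mono {runmin} 0≤runmin (z≤n {a})) ⟩
              t • D (suc a) + partialSum runmin a
                  ≤⟨ partialSum-growth runmin (D (suc a)) a t (λ i _ →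
                  [ (λ h → h) , (λ next → ⊥-elim (¬next next)) ]′
                      (next-or-above a M≤a record-a i)) ⟩
              partialSum runmin (t ℕ.+ a)              <⟨ S<B (t ℕ.+ a) ⟩
              B                        ∎))
        where open ≤-Reasoning

      k•κ≤S : ∀ k → ∃ λ b → Record b × k • κ ≤ partialSum runmin b
      k•κ≤S zero    = M , first-record , partialSum-mono {runmin} 0≤runmin (z≤n {M})
      k•κ≤S (suc k) = case k•κ≤S k of λ where
        (a , record-a , kκ≤) → case next-record a record-a of λ where
          (b , record-b , κ+S≤) → b , record-b , ≤-trans {κ + k • κ} {κ + partialSum runmin a}
              {partialSum runmin b}
            (+-mono-≤ {κ} {κ} {k • κ} {partialSum runmin a} (≤-refl {κ}) kκ≤) κ+S≤

      S-unbounded : ⊥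
      S-unbounded = case archimedean {κ} B 0<κ of λ where
        (k , B≤kκ) → case k•κ≤S k of λ where
          (b , _ , kκ≤) → <-≤-⊥ {partialSum runmin b} {B} (S<B b)
              (≤-trans {B} {k • κ} {partialSum runmin b} B≤kκ kκ≤)

    runmin∈𝒟 : runmin ∈ 𝒟
    runmin∈𝒟 = record
      { nonNegative   = 0≤runmin
      ; nonIncreasing = λ m n _ m≤n → antitone {runmin} runmin-step m≤n
      ; divergent     = unbounded⇒divergent {runmin} 0≤runmin λ B →
          case em {P = ∃ λ N → B ≤ partialSum runmin N} of λ where
            (yes p) → p
            (no ¬p) → ⊥-elim (S-unbounded B λ N → ≰⇒> em {B} {partialSum runmin N} λ B≤ → ¬p
                (N , B≤))
      }

    runmin-not-below : ¬ (∀ ψ → ψ ∈ 𝒟 → ∀ N → ∃ λ n → N ℕ.< n × D n < ψ n)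
    runmin-not-below below = case below runmin runmin∈𝒟 M of λ where
      (n , M<n , D<) → <-≤-⊥ {D n} {runmin n} D< (runmin≤D n M<n)

  not-below-all-𝒟 : ¬ (∀ ψ → ψ ∈ 𝒟 → ∀ N → ∃ λ n → N ℕ.< n × D n < ψ n)
  not-below-all-𝒟 = case eventually-positive of λ where
    (M , 0<D) → runmin-not-below M 0<D

·⇒• : ∀ d m {w w′} → w ≡ w′ → m ≤ d · ‖ w ‖ → m ≤ d • ‖ w′ ‖
·⇒• d m {w} refl h = subst (λ t → m ≤ t) (sym (•≡· d ‖ w ‖)) h


Bad⇒m≤ : ∀ x ((m , _) : Bad x) → ∀ d → 1 ℕ.≤ d → m ≤ d • ‖ d • x ‖
Bad⇒m≤ x (m , isInf , _) d 1≤d = ·⇒• d m {d · x} {d • x} (sym (•≡· d x))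
    (lowerBound (d , ℕ.>-nonZero 1≤d))
  where open IsInfimum isInf

Φ⇒< : ∀ x y → y ∈ Φ x → ∀ ψ → ψ ∈ 𝒟 → ∀ N → ∃ λ n → N ℕ.< n × ‖ n • x + y ‖ < ψ n
Φ⇒< x y y∈Φ ψ ψ∈𝒟 N = case y∈Φ ψ ψ∈𝒟 N of λ where
  (n , N<n , <ψ) → n , N<n , subst (λ t → ‖ t + y ‖ < ψ n) (sym (•≡· n x)) <ψ

-- A rational q below the infimum m takes its place because κ = q / 2 has to be formed.
Bad⇒2κ≤ : ∀ x y m q → (∀ d → 1 ℕ.≤ d → m ≤ d • ‖ d • x ‖) → ℚ⇒ℝ q < m →
  ∀ a d → 1 ℕ.≤ d → ℚ⇒ℝ (½ ℚ.* q) + ℚ⇒ℝ (½ ℚ.* q) ≤ d • (‖ (d ℕ.+ a) • x + y ‖ + ‖ a • x + y ‖)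
Bad⇒2κ≤ x y m q m≤ q<m a d 1≤d = begin
  ℚ⇒ℝ (½ ℚ.* q) + ℚ⇒ℝ (½ ℚ.* q)
      ≈⟨ pointwise-≈ {ℚ⇒ℝ (½ ℚ.* q) + ℚ⇒ℝ (½ ℚ.* q)} {ℚ⇒ℝ q} (λ _ → ½ε+½ε q) ⟩
  ℚ⇒ℝ q                           <⟨ q<m ⟩
  m                               ≤⟨ m≤ d 1≤d ⟩
  d • ‖ d • x ‖                   ≤⟨ •-monoʳ-≤ {‖ d • x ‖} {‖ (d ℕ.+ a) • x + y ‖ + ‖ a • x + y ‖} d
                                       (‖d•x‖≤‖[d+a]•x+y‖+‖a•x+y‖ x y a d) ⟩
  d • (‖ (d ℕ.+ a) • x + y ‖ + ‖ a • x + y ‖)   ∎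
  where open ≤-Reasoning

Bad⇒Φ-empty : ExcludedMiddle 0ℓ → ∀ x y → x ∈ Bad → y ∉ Φ x
Bad⇒Φ-empty em x y bad@(m , _ , 0<m) y∈Φ = case 0<x⇒0<q<x {m} 0<m of λ where
  (q , 0<q , q<m) → Separated.not-below-all-𝒟 em (λ n → ‖ n • x + y ‖) (ℚ⇒ℝ (½ ℚ.* q))
      (ℚ⇒ℝ-mono-< (½ε>0 0<q))
    (Bad⇒2κ≤ x y m q (Bad⇒m≤ x bad) q<m) (Φ⇒< x y y∈Φ)

-- Rational numbers

•-monoʳ-< : ∀ d → 1 ℕ.≤ d → x < y → d • x < d • y
•-monoʳ-< {x} {y} (suc d) _ x<y = +-mono-<-≤ {x} {y} {d • x} {d • y} x<y
    (•-monoʳ-≤ {x} {y} d (<⇒≤ {x} {y} x<y))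

•-cancelˡ-≈ : ∀ d → 1 ℕ.≤ d → d • x ≈ d • y → x ≈ y
•-cancelˡ-≈ {x} {y} d 1≤d dx≈dy = ≤-antisym {x} {y}
  (≮⇒≥ {y} {x} λ y<x → <-≤-⊥ {d • y} {d • x} (•-monoʳ-< {y} {x} d 1≤d y<x)
      (≈⇒≤ {d • x} {d • y} dx≈dy))
  (≮⇒≥ {x} {y} λ x<y → <-≤-⊥ {d • x} {d • y} (•-monoʳ-< {x} {y} d 1≤d x<y)
    (≈⇒≤ {d • y} {d • x} (≈-sym {d • x} {d • y} dx≈dy)))

ℤ⇒ℝ-injective : ∀ i j → ℤ⇒ℝ i ≈ ℤ⇒ℝ j → i ≡ j
ℤ⇒ℝ-injective i j i≈j = case i ℤ.≟ j of λ where
  (yes i≡j) → i≡j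
  (no  i≢j) → ⊥-elim (<-≤-⊥ {0ℝ} {ℚ⇒ℝ 1ℚ} (ℚ⇒ℝ-mono-< (ℚ.positive⁻¹ 1ℚ))
    (≤-trans {ℚ⇒ℝ 1ℚ} {∣ ℤ⇒ℝ i - ℤ⇒ℝ i ∣ + ∣ ℤ⇒ℝ i - ℤ⇒ℝ j ∣} {0ℝ} (i≢j⇒1≤∣x-i∣+∣x-j∣ (ℤ⇒ℝ i) i≢j)
      (+-mono-≤ {∣ ℤ⇒ℝ i - ℤ⇒ℝ i ∣} {0ℝ} {∣ ℤ⇒ℝ i - ℤ⇒ℝ j ∣} {0ℝ}
        (≈⇒∣-∣≤0 {ℤ⇒ℝ i} {ℤ⇒ℝ i} (≈-refl {ℤ⇒ℝ i})) (≈⇒∣-∣≤0 {ℤ⇒ℝ i} {ℤ⇒ℝ j} i≈j))))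

‖‖≤0⇒integer : ExcludedMiddle 0ℓ → ∀ t → ‖ t ‖ ≤ 0ℝ → ∃ λ k → t ≈ ℤ⇒ℝ k
‖‖≤0⇒integer em t ‖t‖≤0 = case ‖‖-attained em t
    (≤-<-trans {‖ t ‖} {0ℝ} {ℚ⇒ℝ ½} ‖t‖≤0 (ℚ⇒ℝ-mono-< (ℚ.positive⁻¹ ½))) of λ where
  (k , ≤‖t‖) → k , ≈-by-∣-∣≤0 {t} {ℤ⇒ℝ k} (≤-trans {∣ t - ℤ⇒ℝ k ∣} {‖ t ‖} {0ℝ} ≤‖t‖ ‖t‖≤0)

•-divide : ∀ d c → 1 ℕ.≤ d → 0ℚ ℚ.< c → ∃ λ e → 0ℚ ℚ.< e × d • ℚ⇒ℝ e ≈ ℚ⇒ℝ c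
•-divide (suc d) c _ 0<c = case ∃-reciprocal d of λ where
  (r , 0<r , r*d≡1) → c ℚ.* r
    , subst (ℚ._< c ℚ.* r) (ℚ.*-zeroʳ c) (ℚ.*-monoʳ-<-pos c {{ℚ.positive 0<c}} 0<r)
    , pointwise-≈ {suc d • ℚ⇒ℝ (c ℚ.* r)} {ℚ⇒ℝ c} λ k → trans (seq-• (suc d) (ℚ⇒ℝ (c ℚ.* r)) k)
        (trans (solve 3 (λ d c r → d :* (c :* r) := c :* (r :* d)) refl (ℤ⇒ℚ (+ suc d)) c r)
          (trans (cong (c ℚ.*_) r*d≡1) (ℚ.*-identityʳ c)))

•-divide-ℤ : ∀ d k → 1 ℕ.≤ d → ∃ λ q → d • ℚ⇒ℝ q ≈ ℤ⇒ℝ k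
•-divide-ℤ (suc d) k _ = case ∃-reciprocal d of λ where
  (r , 0<r , r*d≡1) → ℤ⇒ℚ k ℚ.* r
    , pointwise-≈ {suc d • ℚ⇒ℝ (ℤ⇒ℚ k ℚ.* r)} {ℤ⇒ℝ k} λ n → trans
        (seq-• (suc d) (ℚ⇒ℝ (ℤ⇒ℚ k ℚ.* r)) n)
        (trans (solve 3 (λ d c r → d :* (c :* r) := c :* (r :* d)) refl (ℤ⇒ℚ (+ suc d)) (ℤ⇒ℚ k) r)
          (trans (cong (ℤ⇒ℚ k ℚ.*_) r*d≡1) (ℚ.*-identityʳ (ℤ⇒ℚ k))))

denominator*q≡numerator : ∀ q → ℤ⇒ℚ (ℚ.↧ q) ℚ.* q ≡ ℤ⇒ℚ (ℚ.↥ q)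
denominator*q≡numerator q@(mkℚ n d-1 _) = ℚ.toℚᵘ-injective (begin-equality
  ℚ.toℚᵘ (ℤ⇒ℚ (+ suc d-1) ℚ.* q)             ≃⟨ ℚ.toℚᵘ-homo-* (ℤ⇒ℚ (+ suc d-1)) q ⟩
  ℚ.toℚᵘ (ℤ⇒ℚ (+ suc d-1)) ℚᵘ.* ℚ.toℚᵘ q     ≃⟨ ℚᵘ.*-congʳ {ℚ.toℚᵘ q} (toℚᵘ-ℤ⇒ℚ (+ suc d-1)) ⟩
  ℚᵘ.mkℚᵘ (+ suc d-1) 0 ℚᵘ.* ℚᵘ.mkℚᵘ n d-1   ≃⟨ ℚᵘ.*≡* (trans (ℤ.*-identityʳ (+ suc d-1 ℤ.* n))
    (trans (ℤ.*-comm (+ suc d-1) n) (cong (λ t → n ℤ.* + suc t) (sym (ℕ.+-identityʳ d-1))))) ⟩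
  ℚᵘ.mkℚᵘ n 0                                ≃⟨ toℚᵘ-ℤ⇒ℚ n ⟨
  ℚ.toℚᵘ (ℤ⇒ℚ n)                             ∎)
  where open ℚᵘ.≤-Reasoning

Rational⇒‖d•x‖≤0 : ∀ x → x ∈ Rational → ∃ λ d → 1 ℕ.≤ d × ‖ d • x ‖ ≤ 0ℝ
Rational⇒‖d•x‖≤0 x (q , x≈q) = ℚ.↧ₙ q , s≤s z≤n , ≤-trans {‖ ℚ.↧ₙ q • x ‖} {‖ ℤ⇒ℝ (ℚ.↥ q) ‖} {0ℝ}
  (≈⇒≤ {‖ ℚ.↧ₙ q • x ‖} {‖ ℤ⇒ℝ (ℚ.↥ q) ‖} (‖‖-cong {ℚ.↧ₙ q • x} {ℤ⇒ℝ (ℚ.↥ q)}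
    (≈-trans {ℚ.↧ₙ q • x} {ℚ.↧ₙ q • ℚ⇒ℝ q} {ℤ⇒ℝ (ℚ.↥ q)} (•-congʳ {x} {ℚ⇒ℝ q} (ℚ.↧ₙ q) x≈q)
      (pointwise-≈ {ℚ.↧ₙ q • ℚ⇒ℝ q} {ℤ⇒ℝ (ℚ.↥ q)} λ k →
        trans (seq-• (ℚ.↧ₙ q) (ℚ⇒ℝ q) k) (denominator*q≡numerator q)))))
  (‖ℤ⇒ℝ‖≤0 (ℚ.↥ q))

-- An integral n x = k would force x = k / n.
irrational⇒0<‖n•x‖ : ExcludedMiddle 0ℓ → ∀ x → x ∉ Rational → ∀ n → 1 ℕ.≤ n → 0ℝ < ‖ n • x ‖
irrational⇒0<‖n•x‖ em x x∉ℚ n 1≤n = ≰⇒> em {‖ n • x ‖} {0ℝ} λ ≤0 → case ‖‖≤0⇒integer em (n • x) ≤0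
    of λ where
  (k , nx≈k) → case •-divide-ℤ n k 1≤n of λ where
    (q , nq≈k) → x∉ℚ (q , •-cancelˡ-≈ {x} {ℚ⇒ℝ q} n 1≤n
      (≈-trans {n • x} {ℤ⇒ℝ k} {n • ℚ⇒ℝ q} nx≈k (≈-sym {n • ℚ⇒ℝ q} {ℤ⇒ℝ k} nq≈k)))

-- Past a non-positive value a non-increasing ψ adds nothing positive, so the partial sums would
-- never exceed their value at n.
𝒟⇒positive : ExcludedMiddle 0ℓ → ∀ ψ → ψ ∈ 𝒟 → ∀ n → 1 ℕ.≤ n → 0ℝ < ψ n
𝒟⇒positive em ψ ψ∈𝒟 n 1≤n = ≰⇒> em {ψ n} {0ℝ} λ ψn≤0 → case divergent (partialSum ψ n) of λ where
    (N , h) → <-≤-⊥ {partialSum ψ n} {partialSum ψ (N ℕ.+ n)} (h (N ℕ.+ n) (ℕ.m≤m+n N n))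
        (constant ψn≤0 N)
  where
  open 𝒟 ψ∈𝒟
  open ≤-Reasoning
  constant : ψ n ≤ 0ℝ → ∀ k → partialSum ψ (k ℕ.+ n) ≤ partialSum ψ n
  constant ψn≤0 zero    = ≤-refl {partialSum ψ n}
  constant ψn≤0 (suc k) = begin
    partialSum ψ (k ℕ.+ n) + ψ (suc (k ℕ.+ n))
        ≤⟨ +-mono-≤ {partialSum ψ (k ℕ.+ n)} {partialSum ψ n} {ψ (suc (k ℕ.+ n))} {0ℝ}
        (constant ψn≤0 k) (≤-trans {ψ (suc (k ℕ.+ n))} {ψ n} {0ℝ}
            (nonIncreasing n (suc (k ℕ.+ n)) 1≤n (ℕ.m≤n+m n (suc k))) ψn≤0) ⟩
    partialSum ψ n + 0ℝ
        ≈⟨ pointwise-≈ {partialSum ψ n + 0ℝ} {partialSum ψ n}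
        (λ i → ℚ.+-identityʳ (seq (partialSum ψ n) i)) ⟩
    partialSum ψ n                               ∎

-- Small constants serve as test functions: membership in `Φ x` forces `‖ n • x + y ‖` below every
-- positive constant for some n.
constant∈𝒟 : ∀ δ → 0ℝ < δ → (λ _ → δ) ∈ 𝒟
constant∈𝒟 δ 0<δ = record
  { nonNegative   = λ _ _ → <⇒≤ {0ℝ} {δ} 0<δ
  ; nonIncreasing = λ _ _ _ _ → ≤-refl {δ}
  ; divergent     = unbounded⇒divergent {λ _ → δ} (λ _ _ → <⇒≤ {0ℝ} {δ} 0<δ) λ B → case archimedean
      {δ} B 0<δ of λ where
      (t , B≤tδ) → t ℕ.+ 0 , ≤-trans {B} {t • δ} {partialSum (λ _ → δ) (t ℕ.+ 0)} B≤tδ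
        (≤-trans {t • δ} {t • δ + 0ℝ} {partialSum (λ _ → δ) (t ℕ.+ 0)}
            (x≤x+y {0ℝ} {t • δ} (≤-refl {0ℝ}))
          (partialSum-growth (λ _ → δ) δ 0 t (λ _ _ → ≤-refl {δ})))
  }

<⇒Φ : ∀ x y → (∀ ψ → ψ ∈ 𝒟 → ∀ N → ∃ λ n → N ℕ.< n × ‖ n • x + y ‖ < ψ n) → y ∈ Φ x
<⇒Φ x y below ψ ψ∈𝒟 N = case below ψ ψ∈𝒟 N of λ where
  (n , N<n , <ψ) → n , N<n , subst (λ t → ‖ t + y ‖ < ψ n) (•≡· n x) <ψ

module RationalPoint (em : ExcludedMiddle 0ℓ) (x : ℝ) (d : ℕ) (1≤d : 1 ℕ.≤ d)
    (‖dx‖≤0 : ‖ d • x ‖ ≤ 0ℝ) where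
  open ≤-Reasoning

  ‖n•dx‖≤0 : ∀ n → ‖ n • (d • x) ‖ ≤ 0ℝ
  ‖n•dx‖≤0 n = ≤-trans {‖ n • (d • x) ‖} {n • ‖ d • x ‖} {0ℝ} (‖n•x‖≤n•‖x‖ n (d • x))
      (n•0≤0 {‖ d • x ‖} n ‖dx‖≤0)

  ℤ⇒ℝ∈Φ : ∀ k → ℤ⇒ℝ k ∈ Φ x
  -- Multiples of d make n x an integer; the factor N + 1 carries the index past N.
  ℤ⇒ℝ∈Φ k = <⇒Φ x (ℤ⇒ℝ k) λ ψ ψ∈𝒟 N → suc N ℕ.* d , N<n N , (begin-strict
      ‖ (suc N ℕ.* d) • x + ℤ⇒ℝ k ‖            ≤⟨ ‖x+y‖≤‖x‖+‖y‖ ((suc N ℕ.* d) • x) (ℤ⇒ℝ k) ⟩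
      ‖ (suc N ℕ.* d) • x ‖ + ‖ ℤ⇒ℝ k ‖
          ≤⟨ +-mono-≤ {‖ (suc N ℕ.* d) • x ‖} {0ℝ} {‖ ℤ⇒ℝ k ‖} {0ℝ} (‖n•x‖≤0 N) (‖ℤ⇒ℝ‖≤0 k) ⟩
      0ℝ + 0ℝ                                  ≈⟨ pointwise-≈ {0ℝ + 0ℝ} {0ℝ} (λ _ → refl) ⟩
      0ℝ
          <⟨ 𝒟⇒positive em ψ ψ∈𝒟 (suc N ℕ.* d) (ℕ.≤-trans (s≤s z≤n) (N<n N)) ⟩
      ψ (suc N ℕ.* d)                          ∎)
    where
    N<n : ∀ N → N ℕ.< suc N ℕ.* d
    N<n N = ℕ.m≤m*n (suc N) d {{ℕ.>-nonZero 1≤d}}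
    ‖n•x‖≤0 : ∀ N → ‖ (suc N ℕ.* d) • x ‖ ≤ 0ℝ
    ‖n•x‖≤0 N = ≤-trans {‖ (suc N ℕ.* d) • x ‖} {‖ suc N • (d • x) ‖} {0ℝ}
      (≈⇒≤ {‖ (suc N ℕ.* d) • x ‖} {‖ suc N • (d • x) ‖}
          (‖‖-cong {(suc N ℕ.* d) • x} {suc N • (d • x)}
        (≈-sym {suc N • (d • x)} {(suc N ℕ.* d) • x} (•-assocˡ x (suc N) d))))
      (‖n•dx‖≤0 (suc N))

  -- d y = d (n x + y) - n (d x), and the last term is at distance 0 from ℤ. Thus `‖ n • x + y ‖` is
  -- at least ‖ d y ‖ / d for every n.
  ‖d•y‖≤ : ∀ n y → ‖ d • y ‖ ≤ d • ‖ n • x + y ‖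
  ‖d•y‖≤ n y = begin
    ‖ d • y ‖
        ≈⟨ ‖‖-cong {d • y} {d • (n • x + y) + - (n • (d • x))} dy≈ ⟩
    ‖ d • (n • x + y) + - (n • (d • x)) ‖
        ≤⟨ ‖x+y‖≤‖x‖+‖y‖ (d • (n • x + y)) (- (n • (d • x))) ⟩
    ‖ d • (n • x + y) ‖ + ‖ - (n • (d • x)) ‖
        ≤⟨ +-mono-≤ {‖ d • (n • x + y) ‖} {d • ‖ n • x + y ‖} {‖ - (n • (d • x)) ‖} {0ℝ}
        (‖n•x‖≤n•‖x‖ d (n • x + y))
            (≤-trans {‖ - (n • (d • x)) ‖} {‖ n • (d • x) ‖} {0ℝ} (‖-x‖≤‖x‖ (n • (d • x)))
            (‖n•dx‖≤0 n)) ⟩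
    d • ‖ n • x + y ‖ + 0ℝ
        ≈⟨ pointwise-≈ {d • ‖ n • x + y ‖ + 0ℝ} {d • ‖ n • x + y ‖}
                                                            (λ i → ℚ.+-identityʳ
                                                                (seq (d • ‖ n • x + y ‖) i)) ⟩
    d • ‖ n • x + y ‖                                  ∎
    where
    dy≈ : d • y ≈ d • (n • x + y) + - (n • (d • x))
    dy≈ = pointwise-≈ {d • y} {d • (n • x + y) + - (n • (d • x))} λ k →
      trans (trans (seq-• d y k)
        (solve 4 (λ d n x y → d :* y := d :* (n :* x :+ y) :+ (:- (n :* (d :* x)))) refl
          (ℤ⇒ℚ (+ d)) (ℤ⇒ℚ (+ n)) (seq x k) (seq y k)))
        (sym (cong₂ (λ s t → s ℚ.+ ℚ.- t)
          (trans (seq-• d (n • x + y) k) (cong (λ t → ℤ⇒ℚ (+ d) ℚ.* (t ℚ.+ seq y k)) (seq-• n x k)))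
          (trans (seq-• n (d • x) k) (cong (ℤ⇒ℚ (+ n) ℚ.*_) (seq-• d x k)))))

  Φ⇒‖d•y‖≤0 : ∀ y → y ∈ Φ x → ‖ d • y ‖ ≤ 0ℝ
  Φ⇒‖d•y‖≤0 y y∈Φ = ≮⇒≥ {0ℝ} {‖ d • y ‖} λ 0<‖dy‖ → case 0<x⇒0<q<x {‖ d • y ‖} 0<‖dy‖ of λ where
    (c , 0<c , c<‖dy‖) → case •-divide d c 1≤d 0<c of λ where
      (e , 0<e , de≈c) → case Φ⇒< x y y∈Φ (λ _ → ℚ⇒ℝ e) (constant∈𝒟 (ℚ⇒ℝ e) (ℚ⇒ℝ-mono-< 0<e)) 0 of
          λ where
        (n , _ , <e) → <-irrefl {ℚ⇒ℝ c} (begin-strict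
          ℚ⇒ℝ c                 <⟨ c<‖dy‖ ⟩
          ‖ d • y ‖             ≤⟨ ‖d•y‖≤ n y ⟩
          d • ‖ n • x + y ‖
              ≤⟨ •-monoʳ-≤ {‖ n • x + y ‖} {ℚ⇒ℝ e} d (<⇒≤ {‖ n • x + y ‖} {ℚ⇒ℝ e} <e) ⟩
          d • ℚ⇒ℝ e             ≈⟨ de≈c ⟩
          ℚ⇒ℝ c                 ∎)

  Φ⇒d•y-integer : ∀ y → y ∈ Φ x → ∃ λ k → d • y ≈ ℤ⇒ℝ k
  Φ⇒d•y-integer y y∈Φ = ‖‖≤0⇒integer em (d • y) (Φ⇒‖d•y‖≤0 y y∈Φ)

  -- It is enough to enclose `Φ x`: it contains ℤ, and y ↦ d y embeds it into ℤ.
  #Φ≡ℵ₀ : # Φ x ≡ ℵ₀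
  #Φ≡ℵ₀ = schröder-bernstein em
    (record
      { to        = λ (y , y∈Φ) → ℤ⇒ℕ (proj₁ (Φ⇒d•y-integer y y∈Φ))
      ; cong      = λ {(y , y∈Φ)} {(z , z∈Φ)} y≈z → cong ℤ⇒ℕ
          (same-integer y z y≈z (Φ⇒d•y-integer y y∈Φ) (Φ⇒d•y-integer z z∈Φ))
      ; injective = λ {(y , y∈Φ)} {(z , z∈Φ)} eq → same-point y z (Φ⇒d•y-integer y y∈Φ)
          (Φ⇒d•y-integer z z∈Φ)
                      (ℤ⇒ℕ-injective _ _ eq)
      })
    (record
      { to        = λ n → ℤ⇒ℝ (+ n) , ℤ⇒ℝ∈Φ (+ n)
      ; cong      = λ { {m} refl → ≈-refl {ℤ⇒ℝ (+ m)} }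
      ; injective = λ {m} {n} eq → ℤ.+-injective (ℤ⇒ℝ-injective (+ m) (+ n) eq)
      })
    where
    same-integer : ∀ y z → y ≈ z → ((i , _) : ∃ λ i → d • y ≈ ℤ⇒ℝ i)
        ((j , _) : ∃ λ j → d • z ≈ ℤ⇒ℝ j) → i ≡ j
    same-integer y z y≈z (i , dy≈i) (j , dz≈j) = ℤ⇒ℝ-injective i j
      (≈-trans {ℤ⇒ℝ i} {d • y} {ℤ⇒ℝ j} (≈-sym {d • y} {ℤ⇒ℝ i} dy≈i)
        (≈-trans {d • y} {d • z} {ℤ⇒ℝ j} (•-congʳ {y} {z} d y≈z) dz≈j))
    same-point : ∀ y z → ((i , _) : ∃ λ i → d • y ≈ ℤ⇒ℝ i) ((j , _) : ∃ λ j → d • z ≈ ℤ⇒ℝ j) → i ≡ j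
        → y ≈ z
    same-point y z (i , dy≈i) (.i , dz≈i) refl = •-cancelˡ-≈ {y} {z} d 1≤d
      (≈-trans {d • y} {ℤ⇒ℝ i} {d • z} dy≈i (≈-sym {d • z} {ℤ⇒ℝ i} dz≈i))

Rational⇒#Φ≡ℵ₀ : ExcludedMiddle 0ℓ → ∀ x → x ∈ Rational → # Φ x ≡ ℵ₀
Rational⇒#Φ≡ℵ₀ em x x∈ℚ = case Rational⇒‖d•x‖≤0 x x∈ℚ of λ where
  (d , 1≤d , ‖dx‖≤0) → RationalPoint.#Φ≡ℵ₀ em x d 1≤d ‖dx‖≤0

-- Well approximable irrational numbers

does-≡⇒ : {A B : Set} (a? : Dec A) (b? : Dec B) → does a? ≡ does b? → A → B
does-≡⇒ (yes _) (yes b) _ _ = b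
does-≡⇒ (no ¬a) _       _ a = ⊥-elim (¬a a)

∃-lower-bound : ∀ x → ∃ λ q → ℚ⇒ℝ q ≤ x
∃-lower-bound x = case ∃-upper-bound (- x) of λ where
  (q , -x≤q) → ℚ.- q , ≤-by-difference (- x) (ℚ⇒ℝ q) (ℚ⇒ℝ (ℚ.- q)) x -x≤q
    λ n → solve 2 (λ q x → x :- (:- q) := q :- (:- x)) refl q (seq x n)

monotone : ∀ {f : ℕ → ℝ} → (∀ n → f n ≤ f (suc n)) → ∀ {m n} → m ℕ.≤ n → f m ≤ f n
monotone {f} step {m} m≤n = case ℕ.m≤n⇒∃[o]m+o≡n m≤n of λ where
    (k , refl) → subst (λ n → f m ≤ f n) (ℕ.+-comm k m) (go k)
  where
  go : ∀ k → f m ≤ f (k ℕ.+ m)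
  go zero    = ≤-refl {f m}
  go (suc k) = ≤-trans {f m} {f (k ℕ.+ m)} {f (suc k ℕ.+ m)} (go k) (step (k ℕ.+ m))

partialSum-growth-≤ : ∀ ψ δ a t → (∀ i → ψ (suc (i ℕ.+ a)) ≤ δ) →
                      partialSum ψ (t ℕ.+ a) ≤ partialSum ψ a + t • δ
partialSum-growth-≤ ψ δ a zero    _  = x≤x+y {0ℝ} {partialSum ψ a} (≤-refl {0ℝ})
partialSum-growth-≤ ψ δ a (suc t) ≤δ = begin
  partialSum ψ (t ℕ.+ a) + ψ (suc (t ℕ.+ a))
      ≤⟨ +-mono-≤ {partialSum ψ (t ℕ.+ a)} {partialSum ψ a + t • δ} {ψ (suc (t ℕ.+ a))} {δ}
      (partialSum-growth-≤ ψ δ a t ≤δ) (≤δ t) ⟩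
  partialSum ψ a + t • δ + δ
      ≈⟨ pointwise-≈ {partialSum ψ a + t • δ + δ} {partialSum ψ a + (δ + t • δ)} (λ n →
      solve 3 (λ δ tδ s → s :+ tδ :+ δ := s :+ (δ :+ tδ)) refl (seq δ n) (seq (t • δ) n)
          (seq (partialSum ψ a) n)) ⟩
  partialSum ψ a + (δ + t • δ)                 ∎
  where open ≤-Reasoning

x≤n•x : ∀ n → 1 ℕ.≤ n → 0ℝ ≤ x → x ≤ n • x
x≤n•x {x} n 1≤n 0≤x = ≤-trans {x} {x + 0ℝ} {n • x} (x≤x+y {0ℝ} {x} (≤-refl {0ℝ}))
    (•-monoˡ-≤ {x} {1} {n} 0≤x 1≤n)

-- Choice of the approximations

module Approximations (em : ExcludedMiddle 0ℓ) (N : ℕ → ℝ) (0<N : ∀ q → 1 ℕ.≤ q → 0ℝ < N q)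
  (approximate : ∀ δ → 0ℚ ℚ.< δ → ∃ λ q → 1 ℕ.≤ q × q • N q < ℚ⇒ℝ δ) where
  open ≤-Reasoning

  N≤q•N : ∀ q → 1 ℕ.≤ q → N q ≤ q • N q
  N≤q•N q 1≤q = x≤n•x {N q} q 1≤q (<⇒≤ {0ℝ} {N q} (0<N q 1≤q))

  Close : Set
  Close = ∃ λ q → 1 ℕ.≤ q × N q < ℚ⇒ℝ ½

  -- The factor 8, written 4 + 4 for the two interval radii added up in `once≢twice`, separates
  -- digits; the halving of `q • N q` gives the potential argument its geometric decay.
  Closer : Close → Close → Set
  Closer (q , _) (q′ , _) = 4 • N q′ + 4 • N q′ < N q × q′ • N q′ + q′ • N q′ ≤ q • N q

  first : Close
  first = case approximate ½ (ℚ.positive⁻¹ ½) of λ where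
    (q , 1≤q , T<½) → q , 1≤q , ≤-<-trans {N q} {q • N q} {ℚ⇒ℝ ½} (N≤q•N q 1≤q) T<½

  -- A single demand yields both conditions: `q′ • N q′` below an eighth of `N q`. Since q′ ≥ 1 it
  -- bounds `N q′` as well, and `N q` ≤ `q • N q` turns it into the halving.
  closer : ∀ c → ∃ (Closer c)
  closer (q , 1≤q , N<½) = case 0<x⇒0<q<x {N q} (0<N q 1≤q) of λ where
      (δ , 0<δ , δ<N) → case •-divide 8 δ (s≤s z≤n) 0<δ of λ where
        (e , 0<e , 8e≈δ) → case approximate e 0<e of λ where
          (q′ , 1≤q′ , T′<e) → improve δ δ<N e (ℚ⇒ℝ-mono-≤ (ℚ.<⇒≤ 0<e)) 8e≈δ q′ 1≤q′ T′<e
    where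
    improve : ∀ δ → ℚ⇒ℝ δ < N q → ∀ e → 0ℝ ≤ ℚ⇒ℝ e → 8 • ℚ⇒ℝ e ≈ ℚ⇒ℝ δ →
              ∀ q′ → 1 ℕ.≤ q′ → q′ • N q′ < ℚ⇒ℝ e → ∃ (Closer (q , 1≤q , N<½))
    improve δ δ<N e 0≤e 8e≈δ q′ 1≤q′ T′<e = (q′ , 1≤q′ , N′<½) , 8N′<N , 2T′≤T
      where
      8N′<N : 4 • N q′ + 4 • N q′ < N q
      8N′<N = begin-strict
        4 • N q′ + 4 • N q′    ≈⟨ •-homo-+ (N q′) 4 4 ⟨
        8 • N q′
            ≤⟨ •-monoʳ-≤ {N q′} {ℚ⇒ℝ e} 8
            (<⇒≤ {N q′} {ℚ⇒ℝ e} (≤-<-trans {N q′} {q′ • N q′} {ℚ⇒ℝ e} (N≤q•N q′ 1≤q′) T′<e)) ⟩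
        8 • ℚ⇒ℝ e              ≈⟨ 8e≈δ ⟩
        ℚ⇒ℝ δ                  <⟨ δ<N ⟩
        N q                    ∎
      N′<½ : N q′ < ℚ⇒ℝ ½
      N′<½ = begin-strict
        N q′                   ≤⟨ x≤n•x {N q′} 8 (s≤s z≤n) (<⇒≤ {0ℝ} {N q′} (0<N q′ 1≤q′)) ⟩
        8 • N q′               ≈⟨ •-homo-+ (N q′) 4 4 ⟩
        4 • N q′ + 4 • N q′    <⟨ 8N′<N ⟩
        N q                    <⟨ N<½ ⟩
        ℚ⇒ℝ ½                  ∎
      2T′≤T : q′ • N q′ + q′ • N q′ ≤ q • N q
      2T′≤T = begin
        q′ • N q′ + q′ • N q′
            ≤⟨ +-mono-≤ {q′ • N q′} {ℚ⇒ℝ e} {q′ • N q′} {ℚ⇒ℝ e} (<⇒≤ {q′ • N q′} {ℚ⇒ℝ e} T′<e)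
            (<⇒≤ {q′ • N q′} {ℚ⇒ℝ e} T′<e) ⟩
        ℚ⇒ℝ e + ℚ⇒ℝ e
            ≤⟨ +-mono-≤ {ℚ⇒ℝ e} {ℚ⇒ℝ e} {ℚ⇒ℝ e} {7 • ℚ⇒ℝ e} (≤-refl {ℚ⇒ℝ e})
            (x≤n•x {ℚ⇒ℝ e} 7 (s≤s z≤n) 0≤e) ⟩
        8 • ℚ⇒ℝ e              ≈⟨ 8e≈δ ⟩
        ℚ⇒ℝ δ                  <⟨ δ<N ⟩
        N q                    ≤⟨ N≤q•N q 1≤q ⟩
        q • N q                ∎

  close : ℕ → Close
  close zero    = first
  close (suc i) = proj₁ (closer (close i))

  close-closer : ∀ i → Closer (close i) (close (suc i))
  close-closer i = proj₂ (closer (close i))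

-- Real numbers coded by digit sequences

module SignedSums (em : ExcludedMiddle 0ℓ) (t θ : ℕ → ℝ) (∣θ∣≤t : ∀ i → ∣ θ i ∣ ≤ t i)
    (t≤∣θ∣ : ∀ i → t i ≤ ∣ θ i ∣)
  (8t<t : ∀ i → 4 • t (suc i) + 4 • t (suc i) < t i) where
  open ≤-Reasoning

  once-or-twice : Bool → ℝ → ℝ
  once-or-twice false w = w
  once-or-twice true  w = w + w

  s : (ℕ → Bool) → ℕ → ℝ
  s b zero    = 0ℝ
  s b (suc i) = s b i - once-or-twice (b i) (θ i)

  -- The ends of intervals of radius 4 t i about the partial sums. They are nested: one step moves
  -- the centre by at most 2 t i, and the new radius is at most t i.
  U L : (ℕ → Bool) → ℕ → ℝ
  U b i = s b i + 4 • t i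
  L b i = s b i - 4 • t i

  0≤t : ∀ i → 0ℝ ≤ t i
  0≤t i = ≤-trans {0ℝ} {∣ θ i ∣} {t i} (0≤∣x∣ (θ i)) (∣θ∣≤t i)

  4t≤t : ∀ i → 4 • t (suc i) ≤ t i
  4t≤t i = ≤-trans {4 • t (suc i)} {4 • t (suc i) + 4 • t (suc i)} {t i}
    (x≤x+y {4 • t (suc i)} {4 • t (suc i)} (0≤n•x {t (suc i)} 4 (0≤t (suc i))))
    (<⇒≤ {4 • t (suc i) + 4 • t (suc i)} {t i} (8t<t i))

  once-or-twice≤ : ∀ c {w t} → 0ℝ ≤ t → w ≤ t → once-or-twice c w ≤ t + t
  once-or-twice≤ false {w} {t} 0≤t w≤t = ≤-trans {w} {t} {t + t} w≤t (x≤x+y {t} {t} 0≤t)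
  once-or-twice≤ true  {w} {t} 0≤t w≤t = +-mono-≤ {w} {t} {w} {t} w≤t w≤t

  -once-or-twice≤ : ∀ c {w t} → 0ℝ ≤ t → - w ≤ t → - once-or-twice c w ≤ t + t
  -once-or-twice≤ false {w} {t} 0≤t w≤t = ≤-trans { - w} {t} {t + t} w≤t (x≤x+y {t} {t} 0≤t)
  -once-or-twice≤ true  {w} {t} 0≤t w≤t = ≤-trans { - (w + w)} { - w + - w} {t + t}
    (≈⇒≤ { - (w + w)} { - w + - w}
        (pointwise-≈ { - (w + w)} { - w + - w} λ n → ℚ.neg-distrib-+ (seq w n) (seq w n)))
    (+-mono-≤ { - w} {t} { - w} {t} w≤t w≤t)

  U-step : ∀ b i → U b (suc i) ≤ U b i
  U-step b i = ≤-by-difference (- w + 4 • t (suc i) + 0ℝ) (t i + t i + t i + t i) (U b (suc i))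
      (U b i)
    -- Of the four t i, two cover the move of the centre and one the new radius; the last is spare
    -- and is matched with `0ℝ`.
    (+-mono-≤ { - w + 4 • t (suc i)} {t i + t i + t i} {0ℝ} {t i}
      (+-mono-≤ { - w} {t i + t i} {4 • t (suc i)} {t i}
        (-once-or-twice≤ (b i) {θ i} {t i} (0≤t i)
            (≤-trans { - θ i} {∣ θ i ∣} {t i} (-x≤∣x∣ (θ i)) (∣θ∣≤t i))) (4t≤t i)) (0≤t i))
    λ n → solve 4 (λ s w t t′ → let 4t = t :+ (t :+ (t :+ (t :+ con 0ℚ))) in
        (s :+ 4t) :- ((s :+ (:- w)) :+ t′) := (t :+ t :+ t :+ t) :- ((:- w) :+ t′ :+ con 0ℚ))
      refl (seq (s b i) n) (seq w n) (seq (t i) n) (seq (4 • t (suc i)) n)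
    where w = once-or-twice (b i) (θ i)

  L-step : ∀ b i → L b i ≤ L b (suc i)
  L-step b i = ≤-by-difference (w + 4 • t (suc i) + 0ℝ) (t i + t i + t i + t i) (L b i)
      (L b (suc i))
    (+-mono-≤ {w + 4 • t (suc i)} {t i + t i + t i} {0ℝ} {t i}
      (+-mono-≤ {w} {t i + t i} {4 • t (suc i)} {t i}
        (once-or-twice≤ (b i) {θ i} {t i} (0≤t i)
            (≤-trans {θ i} {∣ θ i ∣} {t i} (x≤∣x∣ (θ i)) (∣θ∣≤t i))) (4t≤t i)) (0≤t i))
    λ n → solve 4 (λ s w t t′ → let 4t = t :+ (t :+ (t :+ (t :+ con 0ℚ))) in
        ((s :+ (:- w)) :+ (:- t′)) :- (s :+ (:- 4t)) := (t :+ t :+ t :+ t) :- (w :+ t′ :+ con 0ℚ))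
      refl (seq (s b i) n) (seq w n) (seq (t i) n) (seq (4 • t (suc i)) n)
    where w = once-or-twice (b i) (θ i)

  L≤U : ∀ b i j → L b i ≤ U b j
  L≤U b i j = begin
    L b i            ≤⟨ monotone {L b} (L-step b) (ℕ.m≤m⊔n i j) ⟩
    L b k            ≤⟨ ≤-by-difference (0ℝ + 0ℝ) (4 • t k + 4 • t k) (L b k) (U b k)
                          (+-mono-≤ {0ℝ} {4 • t k} {0ℝ} {4 • t k} (0≤n•x {t k} 4 (0≤t k))
                              (0≤n•x {t k} 4 (0≤t k)))
                          (λ n → solve 2 (λ s t → (s :+ t) :- (s :+ (:- t)) := (t :+ t) :-
                              (con 0ℚ :+ con 0ℚ))
                            refl (seq (s b k) n) (seq (4 • t k) n)) ⟩
    U b k            ≤⟨ antitone {U b} (U-step b) (ℕ.m≤n⊔m i j) ⟩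
    U b j            ∎
    where k = i ℕ.⊔ j

  infimum-U : ∀ b → ∃ (IsInfimum (U b))
  infimum-U b = case ∃-lower-bound (L b 0) of λ where
    (l , l≤L) → infimum em (U b) 0 l λ i → ≤-trans {ℚ⇒ℝ l} {L b 0} {U b i} l≤L (L≤U b 0 i)

  -- The number - Σ c j θ j, obtained as a point common to all the nested intervals; an infimum over
  -- all stages needs no rate of convergence.
  limit : (ℕ → Bool) → ℝ
  limit b = proj₁ (infimum-U b)

  limit≤U : ∀ b i → limit b ≤ U b i
  limit≤U b = IsInfimum.lowerBound (proj₂ (infimum-U b))

  L≤limit : ∀ b i → L b i ≤ limit b
  L≤limit b i = IsInfimum.greatest (proj₂ (infimum-U b)) (L b i) (L≤U b i)

  step-cong : ∀ i S S′ c c′ → S ≡ S′ → c ≡ c′ → S - once-or-twice c (θ i) ≡ S′ - once-or-twice c′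
      (θ i)
  step-cong i S .S c .c refl refl = refl

  s-cong : ∀ b b′ i → (∀ j → j ℕ.< i → b j ≡ b′ j) → s b i ≡ s b′ i
  s-cong b b′ zero    _  = refl
  s-cong b b′ (suc i) eq = step-cong i (s b i) (s b′ i) (b i) (b′ i)
    (s-cong b b′ i λ j j<i → eq j (ℕ.m<n⇒m<1+n j<i)) (eq i ℕ.≤-refl)

  limit-mono : ∀ b b′ → (∀ i → b i ≡ b′ i) → limit b ≤ limit b′
  limit-mono b b′ eq = IsInfimum.greatest (proj₂ (infimum-U b′)) (limit b) λ i →
    subst (λ s → limit b ≤ s + 4 • t i) (s-cong b b′ i λ j _ → eq j) (limit≤U b i)

  limit-cong : ∀ b b′ → (∀ i → b i ≡ b′ i) → limit b ≈ limit b′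
  limit-cong b b′ eq = ≤-antisym {limit b} {limit b′} (limit-mono b b′ eq)
      (limit-mono b′ b (λ i → sym (eq i)))

  -- The two intervals have radius η = 4 t (i + 1), and their centres are at distance |θ i|. A
  -- common point would give |θ i| ≤ 2η, against 8 t (i + 1) < t i ≤ |θ i|.
  once≢twice : ∀ i S y y′ → y ≈ y′ →
    (S - θ i) - 4 • t (suc i) ≤ y → y ≤ (S - θ i) + 4 • t (suc i) →
    (S - (θ i + θ i)) - 4 • t (suc i) ≤ y′ → y′ ≤ (S - (θ i + θ i)) + 4 • t (suc i) → ⊥
  once≢twice i S y y′ y≈y′ L≤y y≤U L′≤y′ y′≤U′ = <-≤-⊥ {2η} {t i} (8t<t i)
    (≤-trans {t i} {∣ θ i ∣} {2η} (t≤∣θ∣ i) (∣∣-least {θ i} {2η}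
      (≤-by-difference (lo + y′ + y) (y + hi′ + y′) (θ i) 2η
        (+-mono-≤ {lo + y′} {y + hi′} {y} {y′} (+-mono-≤ {lo} {y} {y′} {hi′} L≤y y′≤U′)
            (≈⇒≤ {y} {y′} y≈y′))
        λ n → solve 5 (λ S w t y y′ →
            t :+ t :- w := (y :+ (S :+ (:- (w :+ w)) :+ t) :+ y′) :-
                (S :+ (:- w) :+ (:- t) :+ y′ :+ y))
          refl (seq S n) (seq (θ i) n) (seq η n) (seq y n) (seq y′ n))
      (≤-by-difference (y + lo′ + y′) (hi + y′ + y) (- θ i) 2η
        (+-mono-≤ {y + lo′} {hi + y′} {y′} {y} (+-mono-≤ {y} {hi} {lo′} {y′} y≤U L′≤y′)
          (≈⇒≤ {y′} {y} (≈-sym {y} {y′} y≈y′)))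
        λ n → solve 5 (λ S w t y y′ →
            t :+ t :- (:- w) := (S :+ (:- w) :+ t :+ y′ :+ y) :-
                (y :+ (S :+ (:- (w :+ w)) :+ (:- t)) :+ y′))
          refl (seq S n) (seq (θ i) n) (seq η n) (seq y n) (seq y′ n))))
    where
    η 2η lo hi lo′ hi′ : ℝ
    η   = 4 • t (suc i)
    2η  = η + η
    lo  = (S - θ i) - η
    hi  = (S - θ i) + η
    lo′ = (S - (θ i + θ i)) - η
    hi′ = (S - (θ i + θ i)) + η

  Within : Bool → ℕ → ℝ → ℝ → Set
  Within c i S y = (S - once-or-twice c (θ i)) - 4 • t (suc i) ≤ y × y ≤ (S - once-or-twice c (θ i))
      + 4 • t (suc i)

  digit-unique : ∀ c c′ i S y y′ → y ≈ y′ → Within c i S y → Within c′ i S y′ → c ≡ c′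
  digit-unique false false _ _ _ _  _    _         _           = refl
  digit-unique true  true  _ _ _ _  _    _         _           = refl
  digit-unique false true  i S y y′ y≈y′ (l , u)   (l′ , u′)   = ⊥-elim
      (once≢twice i S y y′ y≈y′ l u l′ u′)
  digit-unique true  false i S y y′ y≈y′ (l , u)   (l′ , u′)   =
    ⊥-elim (once≢twice i S y′ y (≈-sym {y} {y′} y≈y′) l′ u′ l u)

  -- Digits are recovered in order: once those before i agree, both limits are measured from the
  -- same partial sum, and `digit-unique` applies.
  limit-injective : ∀ b b′ → limit b ≈ limit b′ → ∀ i → b i ≡ b′ i
  limit-injective b b′ y≈y′ i = go (suc i) i ℕ.≤-refl
    where
    go : ∀ i j → j ℕ.< i → b j ≡ b′ j
    go (suc i) j j<1+i = case ℕ.m<1+n⇒m<n∨m≡n j<1+i of λ where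
      (inj₁ j<i)  → go i j j<i
      (inj₂ refl) → digit-unique (b i) (b′ i) i (s b i) (limit b) (limit b′) y≈y′
        (L≤limit b (suc i) , limit≤U b (suc i))
        (subst (λ S → Within (b′ i) i S (limit b′)) (sym (s-cong b b′ i (go i)))
            (L≤limit b′ (suc i) , limit≤U b′ (suc i)))

-- Membership of the coded numbers in the fibre over x

multiple : Bool → ℕ → ℕ
multiple false n = n
multiple true  n = n ℕ.+ n

m≤multiple : ∀ c n → n ℕ.≤ multiple c n
m≤multiple false n = ℕ.≤-refl
m≤multiple true  n = ℕ.m≤m+n n n

multiple≤2m : ∀ c n → multiple c n ℕ.≤ n ℕ.+ n
multiple≤2m false n = ℕ.m≤m+n n n
multiple≤2m true  n = ℕ.≤-refl

‖x+y‖≤0 : ∀ x y → ‖ x ‖ ≤ 0ℝ → ‖ y ‖ ≤ 0ℝ → ‖ x + y ‖ ≤ 0ℝ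
‖x+y‖≤0 x y hx hy = ≤-trans {‖ x + y ‖} {‖ x ‖ + ‖ y ‖} {0ℝ} (‖x+y‖≤‖x‖+‖y‖ x y)
  (+-mono-≤ {‖ x ‖} {0ℝ} {‖ y ‖} {0ℝ} hx hy)

‖‖≤0-resp-≈ : x ≈ y → ‖ y ‖ ≤ 0ℝ → ‖ x ‖ ≤ 0ℝ
‖‖≤0-resp-≈ {x} {y} x≈y = ≤-trans {‖ x ‖} {‖ y ‖} {0ℝ} (≈⇒≤ {‖ x ‖} {‖ y ‖} (‖‖-cong {x} {y} x≈y))

module Membership (em : ExcludedMiddle 0ℓ) (x : ℝ) (q : ℕ → ℕ) (1≤q : ∀ i → 1 ℕ.≤ q i)
  (t θ : ℕ → ℝ) (∣θ∣≤t : ∀ i → ∣ θ i ∣ ≤ t i) (t≤∣θ∣ : ∀ i → t i ≤ ∣ θ i ∣)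
  (8t<t : ∀ i → 4 • t (suc i) + 4 • t (suc i) < t i)
  (‖qx-θ‖≤0 : ∀ i → ‖ q i • x - θ i ‖ ≤ 0ℝ)
  (2qt≤qt : ∀ i → q (suc i) • t (suc i) + q (suc i) • t (suc i) ≤ q i • t i) where
  open ≤-Reasoning
  open SignedSums em t θ ∣θ∣≤t t≤∣θ∣ 8t<t

  module _ (b : ℕ → Bool) where

    m : ℕ → ℕ
    m zero    = 0
    m (suc i) = multiple (b i) (q i) ℕ.+ m i

    -- Both c j and q j are at least 1, so the indices m i pass every N, as `W` demands.
    i≤m : ∀ i → i ℕ.≤ m i
    i≤m zero    = z≤n
    i≤m (suc i) = ℕ.+-mono-≤ (ℕ.≤-trans (1≤q i) (m≤multiple (b i) (q i))) (i≤m i)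

    ‖multiple-once-or-twice‖≤0 : ∀ c i → ‖ multiple c (q i) • x - once-or-twice c (θ i) ‖ ≤ 0ℝ
    ‖multiple-once-or-twice‖≤0 false i = ‖qx-θ‖≤0 i
    ‖multiple-once-or-twice‖≤0 true  i = ‖‖≤0-resp-≈ {(q i ℕ.+ q i) • x - (θ i + θ i)}
        {(q i • x - θ i) + (q i • x - θ i)}
      (≈-trans {(q i ℕ.+ q i) • x - (θ i + θ i)} {(q i • x + q i • x) - (θ i + θ i)}
          {(q i • x - θ i) + (q i • x - θ i)}
        (+-cong {(q i ℕ.+ q i) • x} {q i • x + q i • x} { - (θ i + θ i)} { - (θ i + θ i)}
          (•-homo-+ x (q i) (q i)) (≈-refl { - (θ i + θ i)}))
        (pointwise-≈ {(q i • x + q i • x) - (θ i + θ i)} {(q i • x - θ i) + (q i • x - θ i)} λ n →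
          solve 2 (λ a w → (a :+ a) :+ (:- (w :+ w)) := (a :+ (:- w)) :+ (a :+ (:- w))) refl
            (seq (q i • x) n) (seq (θ i) n)))
      (‖x+y‖≤0 (q i • x - θ i) (q i • x - θ i) (‖qx-θ‖≤0 i) (‖qx-θ‖≤0 i))

    -- m i x + s i is the sum of c j (q j x - θ j) over j < i, hence of numbers at distance 0 from
    -- ℤ.
    ‖m•x+s‖≤0 : ∀ i → ‖ m i • x + s b i ‖ ≤ 0ℝ
    ‖m•x+s‖≤0 zero    = pointwise-≤ {‖ 0ℝ + 0ℝ ‖} {0ℝ} λ _ → ‖k‖≤0 (+ 0)
    ‖m•x+s‖≤0 (suc i) = extend (multiple (b i) (q i)) (m i) (s b i) (once-or-twice (b i) (θ i))
        (‖multiple-once-or-twice‖≤0 (b i) i) (‖m•x+s‖≤0 i)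
      where
      extend : ∀ C M S w → ‖ C • x - w ‖ ≤ 0ℝ → ‖ M • x + S ‖ ≤ 0ℝ → ‖ (C ℕ.+ M) • x + (S - w) ‖ ≤
          0ℝ
      extend C M S w hC hM = ‖‖≤0-resp-≈ {(C ℕ.+ M) • x + (S - w)} {(C • x - w) + (M • x + S)}
        (≈-trans {(C ℕ.+ M) • x + (S - w)} {(C • x + M • x) + (S - w)} {(C • x - w) + (M • x + S)}
          (+-cong {(C ℕ.+ M) • x} {C • x + M • x} {S - w} {S - w} (•-homo-+ x C M) (≈-refl {S - w}))
          (pointwise-≈ {(C • x + M • x) + (S - w)} {(C • x - w) + (M • x + S)} λ n →
            solve 4 (λ c m s w → (c :+ m) :+ (s :+ (:- w)) := (c :+ (:- w)) :+ (m :+ s)) refl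
              (seq (C • x) n) (seq (M • x) n) (seq S n) (seq w n)))
        (‖x+y‖≤0 (C • x - w) (M • x + S) hC hM)

    -- Passing from `s b i` to the limit costs at most the radius of the interval.
    ‖m•x+y‖≤4t : ∀ i → ‖ m i • x + limit b ‖ ≤ 4 • t i
    ‖m•x+y‖≤4t i = perturb (m i • x) (s b i) (4 • t i) (limit b) (‖m•x+s‖≤0 i) (limit≤U b i)
        (L≤limit b i)
      where
      perturb : ∀ M S ε y → ‖ M + S ‖ ≤ 0ℝ → y ≤ S + ε → S - ε ≤ y → ‖ M + y ‖ ≤ ε
      perturb M S ε y ‖M+S‖≤0 y≤ ≤y = begin
        ‖ M + y ‖
            ≈⟨ ‖‖-cong {M + y} {(M + S) + (y - S)} (pointwise-≈ {M + y} {(M + S) + (y - S)} λ n →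
            solve 3 (λ m s y → m :+ y := (m :+ s) :+ (y :+ (:- s))) refl (seq M n) (seq S n)
                (seq y n)) ⟩
        ‖ (M + S) + (y - S) ‖        ≤⟨ ‖x+y‖≤‖x‖+‖y‖ (M + S) (y - S) ⟩
        ‖ M + S ‖ + ‖ y - S ‖        ≤⟨ +-mono-≤ {‖ M + S ‖} {0ℝ} {‖ y - S ‖} {ε} ‖M+S‖≤0
            (≤-trans {‖ y - S ‖} {∣ y - S ∣} {ε} (‖x‖≤∣x∣ (y - S)) (∣∣-least {y - S} {ε}
              (≤-by-difference y (S + ε) (y - S) ε y≤ λ n →
                solve 3 (λ s e y → e :- (y :+ (:- s)) := (s :+ e) :- y) refl (seq S n) (seq ε n)
                    (seq y n))
              (≤-by-difference (S - ε) y (- (y - S)) ε ≤y λ n →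
                solve 3 (λ s e y → e :- (:- (y :+ (:- s))) := y :- (s :+ (:- e))) refl (seq S n)
                    (seq ε n) (seq y n)))) ⟩
        0ℝ + ε                       ≈⟨ pointwise-≈ {0ℝ + ε} {ε} (λ n → ℚ.+-identityˡ (seq ε n)) ⟩
        ε                            ∎

    F : ℕ → ℝ
    F i = 4 • (q i • t i)

    2F≤F : ∀ i → F (suc i) + F (suc i) ≤ F i
    2F≤F i = begin
      4 • (q (suc i) • t (suc i)) + 4 • (q (suc i) • t (suc i))
          ≈⟨ •-distrib-+ (q (suc i) • t (suc i)) (q (suc i) • t (suc i)) 4 ⟨
      4 • (q (suc i) • t (suc i) + q (suc i) • t (suc i))
          ≤⟨ •-monoʳ-≤ {q (suc i) • t (suc i) + q (suc i) • t (suc i)} {q i • t i} 4 (2qt≤qt i) ⟩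
      4 • (q i • t i)                                             ∎

    multiple•4t≤2F : ∀ i → multiple (b i) (q i) • (4 • t i) ≤ F i + F i
    multiple•4t≤2F i = begin
      multiple (b i) (q i) • (4 • t i)
          ≤⟨ •-monoˡ-≤ {4 • t i} (0≤n•x {t i} 4 (0≤t i)) (multiple≤2m (b i) (q i)) ⟩
      (q i ℕ.+ q i) • (4 • t i)                 ≈⟨ •-homo-+ (4 • t i) (q i) (q i) ⟩
      q i • (4 • t i) + q i • (4 • t i)
          ≈⟨ +-cong {q i • (4 • t i)} {F i} {q i • (4 • t i)} {F i} swap swap ⟩
      F i + F i                                 ∎
      where
      swap : q i • (4 • t i) ≈ F i
      swap = begin-equality
        q i • (4 • t i)       ≈⟨ •-assocˡ (t i) (q i) 4 ⟩
        (q i ℕ.* 4) • t i     ≡⟨ cong (_• t i) (ℕ.*-comm (q i) 4) ⟩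
        (4 ℕ.* q i) • t i     ≈⟨ •-assocˡ (t i) 4 (q i) ⟨
        4 • (q i • t i)       ∎

    module _ (ψ : ℕ → ℝ) (ψ∈𝒟 : ψ ∈ 𝒟) (N : ℕ) (ψ≤ : ∀ n → N ℕ.< n → ψ n ≤ ‖ n • x + limit b ‖)
        where
      open 𝒟 ψ∈𝒟

      -- The second summand is a reserve of 4 F i for all later growth. The block after m i has at
      -- most 2 q i terms of size at most 4 t i, so it costs 2 F i; the other 2 F i cover the next
      -- reserve because F at least halves.
      potential : ℕ → ℝ
      potential i = partialSum ψ (m i) + ((F i + F i) + (F i + F i))

      potential-step : ∀ i → N ℕ.< i → potential (suc i) ≤ potential i
      potential-step i N<i = begin
        partialSum ψ (multiple (b i) (q i) ℕ.+ m i) +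
            ((F (suc i) + F (suc i)) + (F (suc i) + F (suc i)))
          ≤⟨ +-mono-≤ {partialSum ψ (multiple (b i) (q i) ℕ.+ m i)}
              {partialSum ψ (m i) + (F i + F i)}
               {(F (suc i) + F (suc i)) + (F (suc i) + F (suc i))} {F i + F i}
               (≤-trans {partialSum ψ (multiple (b i) (q i) ℕ.+ m i)}
                   {partialSum ψ (m i) + multiple (b i) (q i) • (4 • t i)}
                 {partialSum ψ (m i) + (F i + F i)}
                 (partialSum-growth-≤ ψ (4 • t i) (m i) (multiple (b i) (q i)) ψ≤4t)
                 (+-mono-≤ {partialSum ψ (m i)} {partialSum ψ (m i)}
                     {multiple (b i) (q i) • (4 • t i)} {F i + F i}
                   (≤-refl {partialSum ψ (m i)}) (multiple•4t≤2F i)))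
               (+-mono-≤ {F (suc i) + F (suc i)} {F i} {F (suc i) + F (suc i)} {F i} (2F≤F i)
                   (2F≤F i)) ⟩
        partialSum ψ (m i) + (F i + F i) + (F i + F i)
          ≈⟨ pointwise-≈ {partialSum ψ (m i) + (F i + F i) + (F i + F i)} {potential i}
               (λ n → ℚ.+-assoc (seq (partialSum ψ (m i)) n) (seq (F i + F i) n)
                   (seq (F i + F i) n)) ⟩
        partialSum ψ (m i) + ((F i + F i) + (F i + F i))
          ∎
        where
        N<m : N ℕ.< m i
        N<m = ℕ.≤-trans N<i (i≤m i)
        -- Since ψ is non-increasing, the one small distance at m i controls all later terms.
        ψ≤4t : ∀ j → ψ (suc (j ℕ.+ m i)) ≤ 4 • t i
        ψ≤4t j = begin
          ψ (suc (j ℕ.+ m i))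
              ≤⟨ nonIncreasing (m i) (suc (j ℕ.+ m i)) (ℕ.≤-trans (s≤s z≤n) N<m)
              (ℕ.m≤n+m (m i) (suc j)) ⟩
          ψ (m i)               ≤⟨ ψ≤ (m i) N<m ⟩
          ‖ m i • x + limit b ‖       ≤⟨ ‖m•x+y‖≤4t i ⟩
          4 • t i               ∎

      potential≤ : ∀ k → potential (k ℕ.+ suc N) ≤ potential (suc N)
      potential≤ zero    = ≤-refl {potential (suc N)}
      potential≤ (suc k) = ≤-trans {potential (suc k ℕ.+ suc N)} {potential (k ℕ.+ suc N)}
          {potential (suc N)}
        (potential-step (k ℕ.+ suc N) (ℕ.m≤n+m (suc N) k)) (potential≤ k)

      0≤F : ∀ i → 0ℝ ≤ F i
      0≤F i = 0≤n•x {q i • t i} 4 (0≤n•x {t i} (q i) (0≤t i))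

      not-divergent : ⊥
      not-divergent = case divergent (potential (suc N)) of λ where
        (M , h) → <-irrefl {potential (suc N)} (begin-strict
          potential (suc N)
              <⟨ h (m (M ℕ.+ suc N)) (ℕ.≤-trans (ℕ.m≤m+n M (suc N)) (i≤m (M ℕ.+ suc N))) ⟩
          partialSum ψ (m (M ℕ.+ suc N))
              ≤⟨ x≤x+y {(F (M ℕ.+ suc N) + F (M ℕ.+ suc N)) + (F (M ℕ.+ suc N) + F (M ℕ.+ suc N))}
              {partialSum ψ (m (M ℕ.+ suc N))}
              (+-mono-≤ {0ℝ} {F (M ℕ.+ suc N) + F (M ℕ.+ suc N)} {0ℝ}
                  {F (M ℕ.+ suc N) + F (M ℕ.+ suc N)}
                (+-mono-≤ {0ℝ} {F (M ℕ.+ suc N)} {0ℝ} {F (M ℕ.+ suc N)} (0≤F (M ℕ.+ suc N))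
                    (0≤F (M ℕ.+ suc N)))
                (+-mono-≤ {0ℝ} {F (M ℕ.+ suc N)} {0ℝ} {F (M ℕ.+ suc N)} (0≤F (M ℕ.+ suc N))
                    (0≤F (M ℕ.+ suc N)))) ⟩
          potential (M ℕ.+ suc N)              ≤⟨ potential≤ M ⟩
          potential (suc N)                    ∎)

    limit∈Φ : limit b ∈ Φ x
    limit∈Φ = <⇒Φ x (limit b) λ ψ ψ∈𝒟 N → case em {P = ∃ λ n → N ℕ.< n × ‖ n • x + limit b ‖ < ψ n}
        of λ where
      (yes below) → below
      (no ¬below) → ⊥-elim
          (not-divergent ψ ψ∈𝒟 N λ n N<n → ≮⇒≥ {‖ n • x + limit b ‖} {ψ n} λ <ψ → ¬below
          (n , N<n , <ψ))

  2^ℵ₀↣Φ : Injection 2^ℵ₀ (subsetoid (Φ x))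
  2^ℵ₀↣Φ = record
    { to        = λ b → limit b , limit∈Φ b
    ; cong      = λ {b} {b′} → limit-cong b b′
    ; injective = λ {b} {b′} → limit-injective b b′
    }

-- A real is determined by the set of rationals below it.
subsetoid↣2^ℵ₀ : ExcludedMiddle 0ℓ → (P : Pred ℝ 0ℓ) → Injection (subsetoid P) 2^ℵ₀
subsetoid↣2^ℵ₀ em P = record
  { to        = λ (y , _) n → does (below? y n)
  ; cong      = λ {(y , _)} {(z , _)} y≈z n → does-⇔
      (mk⇔ (Below-resp-≤ y z n (≈⇒≤ {y} {z} y≈z))
          (Below-resp-≤ z y n (≈⇒≤ {z} {y} (≈-sym {y} {z} y≈z))))
      (below? y n) (below? z n)
  ; injective = λ {(y , _)} {(z , _)} eq → ≤-antisym {y} {z} (digits⇒≤ y z eq)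
      (digits⇒≤ z y λ n → sym (eq n))
  }
  where
  Below : ℝ → ℕ → Set
  Below y n = ∃ λ q → ℚ⇒ℕ q ≡ n × ℚ⇒ℝ q < y
  below? : ∀ y n → Dec (Below y n)
  below? y n = em
  Below-resp-≤ : ∀ y z n → y ≤ z → Below y n → Below z n
  Below-resp-≤ y z n y≤z (q , eq , q<y) = q , eq , <-≤-trans {ℚ⇒ℝ q} {y} {z} q<y y≤z
  digits⇒≤ : ∀ y z → (∀ n → does (below? y n) ≡ does (below? z n)) → y ≤ z
  digits⇒≤ y z eq = ≮⇒≥ {z} {y} λ z<y → case <-dense {z} {y} z<y of λ where
    (q , z<q , q<y) → case does-≡⇒ (below? y (ℚ⇒ℕ q)) (below? z (ℚ⇒ℕ q)) (eq (ℚ⇒ℕ q))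
        (q , refl , q<y) of λ where
      (r , r≡q , r<z) → <-irrefl {z} (<-trans {z} {ℚ⇒ℝ q} {z} z<q
        (subst (λ r → ℚ⇒ℝ r < z) (ℚ⇒ℕ-injective r q r≡q) r<z))

-- Distances below ½ are attained, so there are integers k i for which θ i = q i x - k i has
-- absolute value exactly `‖ q i • x ‖`; subtracting θ i from q i x leaves the integer k i.
close⇒#Φ≡2^ℵ₀ : ExcludedMiddle 0ℓ → ∀ x (q : ℕ → ℕ) → (∀ i → 1 ℕ.≤ q i) →
    (∀ i → ‖ q i • x ‖ < ℚ⇒ℝ ½) →
  (∀ i → 4 • ‖ q (suc i) • x ‖ + 4 • ‖ q (suc i) • x ‖ < ‖ q i • x ‖) →
  (∀ i → q (suc i) • ‖ q (suc i) • x ‖ + q (suc i) • ‖ q (suc i) • x ‖ ≤ q i • ‖ q i • x ‖) →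
  # Φ x ≡ 2^ℵ₀
close⇒#Φ≡2^ℵ₀ em x q 1≤q <½ 8t<t 2qt≤qt = from-integers
    (λ i → proj₁ (‖‖-attained em (q i • x) (<½ i))) (λ i → proj₂ (‖‖-attained em (q i • x) (<½ i)))
  where
  from-integers : (k : ℕ → ℤ) → (∀ i → ∣ q i • x - ℤ⇒ℝ (k i) ∣ ≤ ‖ q i • x ‖) → # Φ x ≡ 2^ℵ₀
  from-integers k ∣θ∣≤t = schröder-bernstein em (subsetoid↣2^ℵ₀ em (Φ x))
    (Membership.2^ℵ₀↣Φ em x q 1≤q (λ i → ‖ q i • x ‖) (λ i → q i • x - ℤ⇒ℝ (k i)) ∣θ∣≤t
      (λ i → IsInfimum.lowerBound (‖‖-isInfimum (q i • x)) (k i)) 8t<t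
      (λ i → ‖‖≤0-resp-≈ {q i • x - (q i • x - ℤ⇒ℝ (k i))} {ℤ⇒ℝ (k i)}
        (pointwise-≈ {q i • x - (q i • x - ℤ⇒ℝ (k i))} {ℤ⇒ℝ (k i)} λ n →
          solve 2 (λ a k → a :+ (:- (a :+ (:- k))) := k) refl (seq (q i • x) n) (ℤ⇒ℚ (k i)))
        (‖ℤ⇒ℝ‖≤0 (k i)))
      2qt≤qt)

•⇒· : ∀ d m {w w′} → w ≡ w′ → m ≤ d • ‖ w ‖ → m ≤ d · ‖ w′ ‖
•⇒· d m {w} refl h = subst (λ t → m ≤ t) (•≡· d ‖ w ‖) h

-- `Bad` asks for the infimum itself, so a positive lower bound has to be completed to one by
-- `infimum`, which is then at least δ.
≤⇒Bad : ExcludedMiddle 0ℓ → ∀ x δ → 0ℚ ℚ.< δ → (∀ n → 1 ℕ.≤ n → ℚ⇒ℝ δ ≤ n • ‖ n • x ‖) → x ∈ Bad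
≤⇒Bad em x δ 0<δ δ≤ = from-infimum (infimum em f (1 , _) δ δ≤f)
  where
  f : ℕ⁺ → ℝ
  f = λ ((n , _) : ℕ⁺) → n · ‖ n · x ‖
  δ≤f : ∀ i → ℚ⇒ℝ δ ≤ f i
  δ≤f (n , nz) = •⇒· n (ℚ⇒ℝ δ) {n • x} {n · x} (•≡· n x) (δ≤ n (ℕ.>-nonZero⁻¹ n {{nz}}))
  from-infimum : ∃ (IsInfimum f) → x ∈ Bad
  from-infimum (m , isInf) = m , isInf , <-≤-trans {0ℝ} {ℚ⇒ℝ δ} {m} (ℚ⇒ℝ-mono-< 0<δ)
    (IsInfimum.greatest isInf (ℚ⇒ℝ δ) δ≤f)

WA⇒approximate : ExcludedMiddle 0ℓ → ∀ x → x ∈ WA → ∀ δ → 0ℚ ℚ.< δ → ∃ λ q → 1 ℕ.≤ q × q • ‖ q • x ‖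
    < ℚ⇒ℝ δ
WA⇒approximate em x x∈WA δ 0<δ = case em {P = ∃ λ q → 1 ℕ.≤ q × q • ‖ q • x ‖ < ℚ⇒ℝ δ} of λ where
  (yes p) → p
  (no ¬p) → ⊥-elim (x∈WA
      (≤⇒Bad em x δ 0<δ λ n 1≤n → ≮⇒≥ {n • ‖ n • x ‖} {ℚ⇒ℝ δ} λ T<δ → ¬p (n , 1≤n , T<δ)))

WA-irrational⇒#Φ≡2^ℵ₀ : ExcludedMiddle 0ℓ → ∀ x → x ∈ WA → x ∉ Rational → # Φ x ≡ 2^ℵ₀
WA-irrational⇒#Φ≡2^ℵ₀ em x x∈WA x∉ℚ = close⇒#Φ≡2^ℵ₀ em x
    (λ i → proj₁ (close i)) (λ i → proj₁ (proj₂ (close i))) (λ i → proj₂ (proj₂ (close i)))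
    (λ i → proj₁ (close-closer i)) (λ i → proj₂ (close-closer i))
  where open Approximations em (λ q → ‖ q • x ‖) (irrational⇒0<‖n•x‖ em x x∉ℚ) (WA⇒approximate em x x∈WA)

theorem19 : ExcludedMiddle 0ℓ → (x : ℝ) →
    (x ∈ Rational → # Φ x ≡ ℵ₀) ×
    (x ∈ WA × x ∉ Rational → # Φ x ≡ 2^ℵ₀) ×
    (x ∈ Bad → # Φ x ≡ 0#)
theorem19 em x = Rational⇒#Φ≡ℵ₀ em x
  , (λ (x∈WA , x∉ℚ) → WA-irrational⇒#Φ≡2^ℵ₀ em x x∈WA x∉ℚ)
  , λ x∈Bad → record
      { to        = λ (y , y∈Φ) → Bad⇒Φ-empty em x y x∈Bad y∈Φ
      ; cong      = λ {(y , y∈Φ)} _ → ⊥-elim (Bad⇒Φ-empty em x y x∈Bad y∈Φ)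
      ; bijective = (λ {(y , y∈Φ)} _ → ⊥-elim (Bad⇒Φ-empty em x y x∈Bad y∈Φ)) , λ ()
      }
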